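{- For every integer $n\ge 3$, the set $\{f(P(n),M): M\in\mathcal{M}_2(P(n))\}$ is continuous, i.e. it is a (possibly empty) interval of integers: if $a<t<b$ are integers with $a,b$ in the set, then $t$ is in the set.
   Context: For $n\ge 3$, $P(n)=P(n,2)$ is the simple graph with vertex set $\{u_i,v_i:0\le i\le n-1\}$ and edge set $\{u_iu_{i+2},\,u_iv_i,\,v_iv_{i+1}:0\le i\le n-1\}$, subscripts modulo $n$. The edges $u_iv_i$ are called spokes. For a perfect matching $M$ of a graph $G$, a forcing set of $M$ is a subset $S\subseteq M$ contained in no perfect matching of $G$ other than $M$; the forcing number $f(G,M)$ is the minimum cardinality of a forcing set of $M$. For $n\neq 4$, $\mathcal{M}_2(P(n))$ is the set of perfect matchings $M$ of $P(n)$ such that either (i) $M$ contains at least one spoke, and for any two (cyclically) consecutive spokes $u_iv_i,u_jv_j$ of $M$ the number of spokes $u_kv_k$ of $P(n)$ strictly between them, $j-i-1$ (with $j$ taken as the representative in $(i,i+n]$), is $\equiv 2\pmod 4$ (if $M$ has exactly one spoke $u_iv_i$, it is regarded as two consecutive spokes with $j=i+n$, so the number is $n-1$); or (ii) $M$ contains no spoke, $4\mid n$, and for some $i$, $M=\bigcup_{k=0}^{n/4-1}\{u_{i+4k}u_{i+4k+2},\,u_{i+4k+1}u_{i+4k+3},\,v_{i+4k+1}v_{i+4k+2},\,v_{i+4k+3}v_{i+4k+4}\}$. For $n=4$, $\mathcal{M}_2(P(4))$ consists of the single perfect matching $\{u_0u_2,u_1u_3,v_1v_2,v_3v_0\}$.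 -}

module Defs where

open import Data.Fin.Base using (Fin; zero; suc; toℕ; _↑ˡ_; _↑ʳ_; splitAt)
open import Data.Fin.Properties using (toℕ-fromℕ<; ↑ˡ-injective; ↑ʳ-injective; splitAt-↑ˡ; splitAt-↑ʳ)
open import Data.Fin.Subset using (Subset; ⁅_⁆; _∪_; ∣_∣) renaming (_∈_ to _∈ᵥ_)
open import Data.Fin.Subset.Properties using (∣⁅x⁆∣≡1; ∪-identityˡ; ∪-identityʳ)
open import Data.List.Base using (List; []; _∷_; length; concatMap; upTo)
open import Data.List.Membership.Propositional using (_∈_; _∉_)
open import Data.List.Relation.Binary.BagAndSetEquality using (_∼[_]_; set)
open import Data.List.Relation.Binary.Subset.Propositional using (_⊆_)
open import Data.List.Relation.Unary.All using (All)
open import Data.List.Relation.Unary.Unique.Propositional using (Unique)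
open import Data.Nat.Base
open import Data.Nat.Divisibility using (_∣_)
open import Data.Nat.DivMod
open import Data.Nat.Properties
open import Data.Product.Base using (∃-syntax; _×_; _,_)
open import Data.Product using (∃!)
open import Data.Sum.Base using (_⊎_; inj₁; inj₂)
open import Relation.Binary.PropositionalEquality
open import Relation.Nullary using (contradiction)
open import Relation.Unary using (Pred) renaming (_∈_ to _∈ₚ_)
open import Level using (0ℓ)

-- An (unordered) edge is a set of vertices; `SimpleGraph` requires it to have
-- exactly two elements.
Edge : ℕ → Set
Edge N = Subset N

record SimpleGraph : Set₁ where
  field
    order  : ℕ
    IsEdge : Pred (Edge order) 0ℓ
    size-2 : ∀ {e} → IsEdge e → ∣ e ∣ ≡ 2

｛_,_｝ : ∀ {N} → Fin N → Fin N → Edge N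
｛ x , y ｝ = ⁅ x ⁆ ∪ ⁅ y ⁆

∣pair∣≡2 : ∀ {N} {x y : Fin N} → x ≢ y → ∣ ｛ x , y ｝ ∣ ≡ 2
∣pair∣≡2 {x = zero}  {zero}  x≢y = contradiction refl x≢y
∣pair∣≡2 {x = zero}  {suc y} _   =
  cong suc (trans (cong ∣_∣ (∪-identityˡ ⁅ y ⁆)) (∣⁅x⁆∣≡1 y))
∣pair∣≡2 {x = suc x} {zero}  _   =
  cong suc (trans (cong ∣_∣ (∪-identityʳ ⁅ x ⁆)) (∣⁅x⁆∣≡1 x))
∣pair∣≡2 {x = suc x} {suc y} x≢y = ∣pair∣≡2 (λ eq → x≢y (cong suc eq))

-- A finite set of edges is a duplicate-free list, so that `length` is its
-- cardinality; the order of the list is irrelevant, and two such sets are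
-- compared by `_∼[ set ]_` (same elements).
EdgeSet : ℕ → Set
EdgeSet N = List (Edge N)

module _ (G : SimpleGraph) where
  open SimpleGraph G

  record IsPerfectMatching (M : EdgeSet order) : Set where
    field
      unique : Unique M
      edges  : All IsEdge M
      covers : ∀ (x : Fin order) → ∃! _≡_ (λ e → e ∈ M × x ∈ᵥ e)

  record IsForcingSet (M S : EdgeSet order) : Set where
    field
      unique  : Unique S
      subset  : S ⊆ M
      forcing : ∀ M′ → IsPerfectMatching M′ → S ⊆ M′ → M′ ∼[ set ] M

  -- ForcingNumber M k is f(G,M) = k, the minimum being stated relationally.
  record ForcingNumber (M : EdgeSet order) (k : ℕ) : Set where
    field
      attained : ∃[ S ] IsForcingSet M S × length S ≡ k
      minimal  : ∀ S → IsForcingSet M S → k ≤ length S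

module Petersen (n : ℕ) .{{_ : NonZero n}} where

  -- Subscripts are arbitrary naturals, read modulo n.
  u v : ℕ → Fin (n + n)
  u i = (i mod n) ↑ˡ n
  v i = n ↑ʳ (i mod n)

  uu spoke vv : ℕ → Edge (n + n)
  uu    i = ｛ u i , u (i + 2) ｝
  spoke i = ｛ u i , v i ｝
  vv    i = ｛ v i , v (i + 1) ｝

  IsEdgeP : Pred (Edge (n + n)) 0ℓ
  IsEdgeP e = ∃[ i ] i < n × (e ≡ uu i ⊎ e ≡ spoke i ⊎ e ≡ vv i)

  u≢v : ∀ i j → u i ≢ v j
  u≢v i j eq with trans (sym (splitAt-↑ˡ n (i mod n) n))
                        (trans (cong (splitAt n) eq) (splitAt-↑ʳ n n (j mod n)))
  ... | ()

mod-shift : ∀ n .{{_ : NonZero n}} i d .{{_ : NonZero d}} → d < n → i mod n ≢ (i + d) mod n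
mod-shift n@(suc m) i d d<n eq = ≢-nonZero⁻¹ d (begin
  d                               ≡⟨ m<n⇒m%n≡m d<n ⟨
  d % n                           ≡⟨ [m+kn]%n≡m%n d i n ⟨
  (d + i * n) % n                 ≡⟨ cong (λ z → (d + z) % n) (*-suc i m) ⟩
  (d + (i + i * m)) % n           ≡⟨ cong (_% n) (trans (sym (+-assoc d i (i * m))) (cong (_+ i * m) (+-comm d i))) ⟩
  (i + d + i * m) % n             ≡⟨ %-distribˡ-+ (i + d) (i * m) n ⟩
  ((i + d) % n + (i * m) % n) % n ≡⟨ cong (λ z → (z + (i * m) % n) % n) eq′ ⟨
  (i % n + (i * m) % n) % n       ≡⟨ %-distribˡ-+ i (i * m) n ⟨
  (i + i * m) % n                 ≡⟨ cong (_% n) (*-suc i m) ⟨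
  (i * n) % n                     ≡⟨ m*n%n≡0 i n ⟩
  0                               ∎)
  where
  open ≡-Reasoning
  eq′ : i % n ≡ (i + d) % n
  eq′ = trans (sym (toℕ-fromℕ< (m%n<n i n)))
              (trans (cong toℕ eq) (toℕ-fromℕ< (m%n<n (i + d) n)))

3≤⇒nonZero : ∀ {n} → 3 ≤ n → NonZero n
3≤⇒nonZero n≥3 = >-nonZero (≤-trans (s≤s z≤n) n≥3)

P : (n : ℕ) → 3 ≤ n → SimpleGraph
P n n≥3 = record
  { order  = n + n
  ; IsEdge = IsEdgeP
  ; size-2 = λ where
      (i , _ , inj₁ refl)        → ∣pair∣≡2 λ eq →
        mod-shift n i 2 n≥3 (↑ˡ-injective n _ _ eq)
      (i , _ , inj₂ (inj₁ refl)) → ∣pair∣≡2 (u≢v i i)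
      (i , _ , inj₂ (inj₂ refl)) → ∣pair∣≡2 λ eq →
        mod-shift n i 1 (≤-trans (n≤1+n 2) n≥3) (↑ʳ-injective n _ _ eq)
  }
  where
  instance _ = 3≤⇒nonZero n≥3
  open Petersen n

module _ (n : ℕ) (n≥3 : 3 ≤ n) where

  private instance
    n≢0 : NonZero n
    n≢0 = 3≤⇒nonZero n≥3

  open Petersen n

  -- Spokes i < j of M that are cyclically consecutive, where 0 ≤ i < n and
  -- j is the representative of its class modulo n in (i , i + n]; the case
  -- j = i + n arises exactly when M has a single spoke.
  ConsecutiveSpokes : EdgeSet (n + n) → ℕ → ℕ → Set
  ConsecutiveSpokes M i j =
    i < n × i < j × j ≤ i + n ×
    spoke i ∈ M × spoke j ∈ M × (∀ k → i < k → k < j → spoke k ∉ M)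

  SpokeCase : EdgeSet (n + n) → Set
  SpokeCase M =
    (∃[ i ] spoke i ∈ M) ×
    (∀ i j → ConsecutiveSpokes M i j → (j ∸ i ∸ 1) % 4 ≡ 2)

  block : ℕ → EdgeSet (n + n)
  block j =
    ｛ u j       , u (j + 2) ｝ ∷
    ｛ u (j + 1) , u (j + 3) ｝ ∷
    ｛ v (j + 1) , v (j + 2) ｝ ∷
    ｛ v (j + 3) , v (j + 4) ｝ ∷ []

  SpokelessCase : EdgeSet (n + n) → Set
  SpokelessCase M =
    (∀ i → spoke i ∉ M) × 4 ∣ n ×
    (∃[ i ] M ∼[ set ] concatMap (λ k → block (i + 4 * k)) (upTo (n / 4)))

  FourCase : EdgeSet (n + n) → Set
  FourCase M =
    M ∼[ set ] (｛ u 0 , u 2 ｝ ∷ ｛ u 1 , u 3 ｝ ∷ ｛ v 1 , v 2 ｝ ∷ ｛ v 3 , v 0 ｝ ∷ [])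

  ℳ₂ : Pred (EdgeSet (n + n)) 0ℓ
  ℳ₂ M = IsPerfectMatching (P n n≥3) M ×
    ((n ≢ 4 × (SpokeCase M ⊎ SpokelessCase M)) ⊎ (n ≡ 4 × FourCase M))

  Spectrum₂ : Pred ℕ 0ℓ
  Spectrum₂ k = ∃[ M ] (M ∈ₚ ℳ₂ × ForcingNumber (P n n≥3) M k)

Continuous : Pred ℕ 0ℓ → Set
Continuous A = ∀ a t b → a ∈ₚ A → b ∈ₚ A → a < t → t < b → t ∈ₚ A

{-# OPTIONS --safe #-}

-- Cut P(n,2) between the indices i − 1 and i. The chosen edges among vvᵢ₋₁, uuᵢ₋₂
-- and uuᵢ₋₁ form the state of the cut, and the perfect matchings become the closed
-- runs of a small automaton on these states. It has two components, according to
-- the parity of the number of crossing edges, and ℳ₂ is the odd one: apart from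
-- n = 4, its members are the cyclic words of tiles v u s (a spoke, after a gap
-- ≡ 2 mod 4) and v u uv ∅, of lengths 3 and 4.
--
-- Let f(w) be the forcing number of a cyclic word w. Exchanging two adjacent tiles,
-- or 3333 for 444, changes f by at most 1: a part σA of a forcing set inside a
-- window can be traded for a set σB, at most one larger, in the new window, such
-- that every matching above σB can be turned into one above σA without changing
-- the window's end states. This is a finite check over all σA. All words of
-- length n containing a 3 are linked by such exchanges, so every value between two
-- values of f is attained on the way. The word 4…4 is linked to 33334…4 and is
-- needed as an end point only.

module Submission where

open import Defs
open import Data.Bool.Base as Bool using (Bool; true; false; not; _∨_; _xor_; f≤t; b≤b; if_then_else_)
import Data.Bool.Properties as Bool
open import Data.Fin.Base using (Fin; toℕ; zero; suc; splitAt; _↑ˡ_; _↑ʳ_)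
import Data.Fin.Properties as Fin
open import Data.Fin.Subset using () renaming (_∈_ to _∈ᵥ_)
open import Data.Fin.Subset.Properties using (x∈⁅x⁆; x∈⁅y⁆⇒x≡y; x∈p∪q⁻; x∈p∪q⁺)
open import Data.List.Base
  using (List; []; _∷_; _++_; [_]; length; map; concatMap; cartesianProduct; filter; foldr; replicate)
import Data.List.Membership.DecPropositional as DecMembership
open import Data.List.Membership.Propositional using (_∈_; _∉_; lose; find)
open import Data.List.Membership.Propositional.Properties
import Data.List.Properties as List
open import Data.List.Relation.Binary.BagAndSetEquality using (_∼[_]_; set)
open import Data.List.Relation.Binary.Permutation.Propositional as Perm using (_↭_; ↭-sym; ↭-refl; ↭-trans)
open import Data.List.Relation.Binary.Permutation.Propositional.Properties using (shift; ∈-resp-↭)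
open import Data.List.Relation.Binary.Pointwise as Pointwise using (Pointwise; []; _∷_)
open import Data.List.Relation.Binary.Subset.Propositional using (_⊆_)
open import Data.List.Relation.Unary.All as All using (All; []; _∷_; all?)
open import Data.List.Relation.Unary.AllPairs using ([]; _∷_)
open import Data.List.Relation.Unary.Any using (Any; here; there; any?)
open import Data.List.Relation.Unary.Unique.Propositional using (Unique)
import Data.List.Relation.Unary.Unique.Propositional.Properties as Unique
open import Data.Nat.Base
open import Data.Nat.Divisibility using (divides; ∣⇒≤)
open import Data.Nat.DivMod
open import Data.Nat.Properties
open import Data.Product.Base as Product using (∃₂; ∃-syntax; _×_; _,_; proj₁; proj₂; map₁)
open import Data.Product using (∃!)
open import Data.Product.Properties using () renaming (≡-dec to ×-≡-dec)
open import Data.Sum.Base as Sum using (_⊎_; inj₁; inj₂)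
import Data.Vec.Properties as Vec
open import Function.Base using (_∘_)
open import Function.Bundles using (Equivalence; mk⇔)
open import Relation.Binary.Construct.Closure.ReflexiveTransitive using (Star; ε; _◅_; _◅◅_; reverse)
open import Relation.Binary.Definitions using (tri<; tri≈; tri>)
open import Relation.Binary.PropositionalEquality hiding ([_])
open import Relation.Nullary using (Dec; yes; no; ¬_; contradiction; does)
open import Relation.Nullary.Decidable
  using (map′; _×-dec_; _→-dec_; _⊎-dec_; dec-true; from-yes; True; toWitness)

-- Words and closed runs

-- At position i a letter records whether uuᵢ, spokeᵢ, vvᵢ are chosen; the state
-- of the cut before i records vvᵢ₋₁, uuᵢ₋₂, uuᵢ₋₁, the chosen edges crossing it.
Letter State : Set
Letter = Bool × Bool × Bool
State  = Bool × Bool × Bool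

Word : Set
Word = List Letter

one : Bool → Bool → Bool → Bool
one true  b c = not (b ∨ c)
one false b c = b xor c

-- At index i the state holds vvᵢ₋₁ and uuᵢ₋₂ as `x` and `p`, so the two equations say that uᵢ and
-- vᵢ are each covered exactly once. The third component, uuᵢ₋₁, ends at uᵢ₊₁ and is passed on by
-- `next`.
Fits : State → Letter → Set
Fits (x , p , _) (u , s , v) = one p s u ≡ true × one x s v ≡ true

next : State → Letter → State
next (_ , _ , q) (u , _ , v) = v , q , u

data Run : State → Word → State → Set where
  []  : ∀ {s} → Run s [] s
  _∷_ : ∀ {s a w t} → Fits s a → Run (next s a) w t → Run s (a ∷ w) t

_++ᴿ_ : ∀ {s t r w w′} → Run s w t → Run t w′ r → Run s (w ++ w′) r
[]       ++ᴿ ρ′ = ρ′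
(φ ∷ ρ) ++ᴿ ρ′ = φ ∷ (ρ ++ᴿ ρ′)

splitᴿ : ∀ w {w′ s r} → Run s (w ++ w′) r → ∃[ t ] Run s w t × Run t w′ r
splitᴿ []      ρ       = _ , [] , ρ
splitᴿ (a ∷ w) (φ ∷ ρ) = let t , ρ₁ , ρ₂ = splitᴿ w ρ in t , φ ∷ ρ₁ , ρ₂

Closed : Word → Set
Closed w = ∃[ s ] Run s w s

_≼_ : Letter → Letter → Set
(u , s , v) ≼ (u′ , s′ , v′) = u Bool.≤ u′ × s Bool.≤ s′ × v Bool.≤ v′

_⊑_ : Word → Word → Set
_⊑_ = Pointwise _≼_

≼-trans : ∀ {a b c} → a ≼ b → b ≼ c → a ≼ c
≼-trans (p , q , r) (p′ , q′ , r′) = Bool.≤-trans p p′ , Bool.≤-trans q q′ , Bool.≤-trans r r′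

⊑-trans : ∀ {σ τ w} → σ ⊑ τ → τ ⊑ w → σ ⊑ w
⊑-trans = Pointwise.transitive ≼-trans

split⊑ : ∀ σ {σ′ w} → (σ ++ σ′) ⊑ w → ∃₂ λ w₁ w₂ → w ≡ w₁ ++ w₂ × σ ⊑ w₁ × σ′ ⊑ w₂
split⊑ []      le       = [] , _ , refl , [] , le
split⊑ (c ∷ σ) (l ∷ le) =
  let w₁ , w₂ , eq , le₁ , le₂ = split⊑ σ le in _ ∷ w₁ , w₂ , cong (_ ∷_) eq , l ∷ le₁ , le₂

split⊒ : ∀ w {w′ σ} → σ ⊑ (w ++ w′) → ∃₂ λ σ₁ σ₂ → σ ≡ σ₁ ++ σ₂ × σ₁ ⊑ w × σ₂ ⊑ w′
split⊒ []      le       = [] , _ , refl , [] , le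
split⊒ (a ∷ w) (l ∷ le) =
  let σ₁ , σ₂ , eq , le₁ , le₂ = split⊒ w le in _ ∷ σ₁ , σ₂ , cong (_ ∷_) eq , l ∷ le₁ , le₂

-- Weights and forcing masks

bit : Bool → ℕ
bit b = if b then 1 else 0

size : Letter → ℕ
size (u , s , v) = bit u + (bit s + bit v)

weight : Word → ℕ
weight []      = 0
weight (a ∷ w) = size a + weight w

weight-++ : ∀ σ σ′ → weight (σ ++ σ′) ≡ weight σ + weight σ′
weight-++ []      σ′ = refl
weight-++ (a ∷ σ) σ′ = trans (cong (size a +_) (weight-++ σ σ′)) (sym (+-assoc (size a) _ _))

-- A mask `σ` marks a subset of the chosen edges of `w`. The competitors `w′` are closed runs from
-- any start state, so matchings of both parities take part.
Forces : Word → Word → Set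
Forces σ w = σ ⊑ w × (∀ w′ → Closed w′ → σ ⊑ w′ → w′ ≡ w)

-- The forcing number enters only through upper bounds: this says that it is at most `k`.
Forceable : Word → ℕ → Set
Forceable w k = ∃[ σ ] Forces σ w × weight σ ≤ k

Forceable-mono : ∀ {w j k} → j ≤ k → Forceable w j → Forceable w k
Forceable-mono j≤k (σ , fs , le) = σ , fs , ≤-trans le j≤k

++-injective : ∀ {A : Set} (xs xs′ : List A) {ys ys′} → length xs ≡ length xs′ →
               xs ++ ys ≡ xs′ ++ ys′ → xs ≡ xs′ × ys ≡ ys′
++-injective []       []         _   eq = refl , eq
++-injective (x ∷ xs) (x′ ∷ xs′) len eq with refl , eq′ ← List.∷-injective eq =
  let a , b = ++-injective xs xs′ (suc-injective len) eq′ in cong (x ∷_) a , b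

-- A closed run may be cut open at any of its states and stays closed, so masks and their
-- competitors rotate together.
Forceable-rotate : ∀ w w′ {k} → Forceable (w ++ w′) k → Forceable (w′ ++ w) k
Forceable-rotate w w′ (σ , (σ⊑ , only) , le) with split⊒ w σ⊑
... | σ₁ , σ₂ , refl , le₁ , le₂ =
  σ₂ ++ σ₁ , (Pointwise.++⁺ le₂ le₁ , only′) ,
  ≤-trans (≤-reflexive (trans (weight-++ σ₂ σ₁) (trans (+-comm (weight σ₂) _) (sym (weight-++ σ₁ σ₂))))) le
  where
  only′ : ∀ w″ → Closed w″ → (σ₂ ++ σ₁) ⊑ w″ → w″ ≡ w′ ++ w
  only′ w″ (s , ρ) le″ with split⊑ σ₂ le″
  ... | x , y , refl , σ₂⊑x , σ₁⊑y =
    let t , ρ₁ , ρ₂ = splitᴿ x ρ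
        eq₁ , eq₂ = ++-injective y w
          (trans (sym (Pointwise.Pointwise-length σ₁⊑y)) (Pointwise.Pointwise-length le₁))
          (only (y ++ x) (t , ρ₂ ++ᴿ ρ₁) (Pointwise.++⁺ σ₁⊑y σ₂⊑x))
    in cong₂ _++_ eq₂ eq₁

-- Every partial word above σB can be replaced, with the same end states, by one
-- above σA; replacing B by A in the matching then transports a second matching
-- above the mask of B to a second matching above the mask of A.
Dominates : (σA σB A B : Word) → Set
Dominates σA σB A B = ∀ s t w → Run s w t → σB ⊑ w →
  ∃[ w′ ] Run s w′ t × σA ⊑ w′ × (w′ ≡ A → w ≡ B)

Replaceable : (σA A B : Word) → Set
Replaceable σA A B = ∃[ σB ] σB ⊑ B × weight σB ≤ suc (weight σA) × Dominates σA σB A B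

-- A closed word `x ++ y` above the new mask is pulled back to `x′ ++ y` above the old one; the end
-- states of `x` are kept, so it is still closed. The old mask forces `x′ ≡ A` and `y ≡ r`, and
-- domination then gives `x ≡ B`.
Forces-replace : ∀ {σA σB A B σ r} → σA ⊑ A → σB ⊑ B → Dominates σA σB A B →
                 σ ⊑ r → Forces (σA ++ σ) (A ++ r) → Forces (σB ++ σ) (B ++ r)
Forces-replace {σA} {σB} {A} {B} {σ} {r} σA⊑A σB⊑B dom σ⊑r (_ , only) =
  Pointwise.++⁺ σB⊑B σ⊑r , only′
  where
  only′ : ∀ w → Closed w → (σB ++ σ) ⊑ w → w ≡ B ++ r
  only′ w (s , ρ) le with split⊑ σB le
  ... | x , y , refl , σB⊑x , σ⊑y with splitᴿ x ρ
  ... | t , ρ₁ , ρ₂ with dom s t x ρ₁ σB⊑x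
  ... | x′ , ρ₁′ , σA⊑x′ , back =
    let eq₁ , eq₂ = ++-injective x′ A
          (trans (sym (Pointwise.Pointwise-length σA⊑x′)) (Pointwise.Pointwise-length σA⊑A))
          (only (x′ ++ y) (s , ρ₁′ ++ᴿ ρ₂) (Pointwise.++⁺ σA⊑x′ σ⊑y))
    in cong₂ _++_ (back eq₁) eq₂

-- The target window may depend on which part σA of the forcing mask falls into the window `A`.
Forceable-replace⊎ : ∀ {A B C} →
  (∀ σA → σA ⊑ A → Replaceable σA A B ⊎ Replaceable σA A C) →
  ∀ r {k} → Forceable (A ++ r) k → Forceable (B ++ r) (suc k) ⊎ Forceable (C ++ r) (suc k)
Forceable-replace⊎ {A} rep r {k} (σ , fs@(σ⊑ , _) , le) with split⊒ A σ⊑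
... | σA , σr , refl , σA⊑A , σr⊑r = Sum.map replace replace (rep σA σA⊑A)
  where
  replace : ∀ {B} → Replaceable σA A B → Forceable (B ++ r) (suc k)
  replace (σB , σB⊑B , wt , dom) = σB ++ σr , Forces-replace σA⊑A σB⊑B dom σr⊑r fs , (begin
    weight (σB ++ σr)              ≡⟨ weight-++ σB σr ⟩
    weight σB + weight σr          ≤⟨ +-monoˡ-≤ (weight σr) wt ⟩
    suc (weight σA + weight σr)    ≡⟨ cong suc (weight-++ σA σr) ⟨
    suc (weight (σA ++ σr))        ≤⟨ s≤s le ⟩
    suc k                          ∎)
    where open ≤-Reasoning

Forceable-replace : ∀ {A B} → (∀ σA → σA ⊑ A → Replaceable σA A B) →
  ∀ r {k} → Forceable (A ++ r) k → Forceable (B ++ r) (suc k)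
Forceable-replace rep r f = Sum.reduce (Forceable-replace⊎ (λ σA le → inj₁ (rep σA le)) r f)

-- Decision procedures

bools : List Bool
bools = true ∷ false ∷ []

triples : List (Bool × Bool × Bool)
triples = cartesianProduct bools (cartesianProduct bools bools)

∈-triples : ∀ a → a ∈ triples
∈-triples (u , s , v) = ∈-cartesianProduct⁺ (∈-bools u) (∈-cartesianProduct⁺ (∈-bools s) (∈-bools v))
  where
  ∈-bools : ∀ b → b ∈ bools
  ∈-bools true  = here refl
  ∈-bools false = there (here refl)

triple-≟ : (a b : Bool × Bool × Bool) → Dec (a ≡ b)
triple-≟ = ×-≡-dec Bool._≟_ (×-≡-dec Bool._≟_ Bool._≟_)

word-≟ : (w w′ : Word) → Dec (w ≡ w′)
word-≟ = List.≡-dec triple-≟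

fits? : ∀ s a → Dec (Fits s a)
fits? (x , p , _) (u , s , v) = (one p s u Bool.≟ true) ×-dec (one x s v Bool.≟ true)

_≼?_ : ∀ a b → Dec (a ≼ b)
(u , s , v) ≼? (u′ , s′ , v′) = (u Bool.≤? u′) ×-dec (s Bool.≤? s′) ×-dec (v Bool.≤? v′)

_⊑?_ : ∀ σ w → Dec (σ ⊑ w)
_⊑?_ = Pointwise.decidable _≼?_

∈-concatMap : ∀ {A B : Set} (f : A → List B) {x xs y} → x ∈ xs → y ∈ f x → y ∈ concatMap f xs
∈-concatMap f x∈xs y∈fx = ∈-concatMap⁺ f (lose x∈xs y∈fx)

-- If uuᵢ₋₂ is chosen, only vᵢ may still need covering; if only vvᵢ₋₁ covers index i, uuᵢ must
-- follow; if neither does, there is one free choice, spokeᵢ or uuᵢ with vvᵢ. Later case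
-- distinctions by `here` and `there` follow the order of this table.
options : State → List Letter
options (x     , true  , _) = [ false , false , not x ]
options (true  , false , _) = [ true , false , false ]
options (false , false , _) = (false , true , false) ∷ (true , false , true) ∷ []

_∈?_ : ∀ a as → Dec (a ∈ as)
a ∈? as = any? (triple-≟ a) as

∈-options : ∀ {s a} → Fits s a → a ∈ options s
∈-options {s} {a} φ = All.lookup (All.lookup check (∈-triples s)) (∈-triples a) φ
  where
  check : All (λ s → All (λ a → Fits s a → a ∈ options s) triples) triples
  check = from-yes (all? (λ s → all? (λ a → fits? s a →-dec (a ∈? options s)) triples) triples)

options-sound : ∀ {s a} → a ∈ options s → Fits s a
options-sound {s} {a} a∈ = All.lookup (All.lookup check (∈-triples s)) (∈-triples a) a∈
  where
  check : All (λ s → All (λ a → a ∈ options s → Fits s a) triples) triples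
  check = from-yes (all? (λ s → all? (λ a → (a ∈? options s) →-dec fits? s a) triples) triples)

letters : State → Letter → List Letter
letters s c = filter (c ≼?_) (options s)

completions : State → Word → List (Word × State)
completions s []      = [ [] , s ]
completions s (c ∷ σ) = concatMap (λ a → map (map₁ (a ∷_)) (completions (next s a) σ)) (letters s c)

∈-completions : ∀ {s t w} → Run s w t → ∀ {σ} → σ ⊑ w → (w , t) ∈ completions s σ
∈-completions []                []       = here refl
∈-completions {s} {w = a ∷ w} (φ ∷ ρ) {c ∷ σ} (l ∷ le) =
  ∈-concatMap (λ a → map (map₁ (a ∷_)) (completions (next s a) σ)) {xs = letters s c}
    (∈-filter⁺ (c ≼?_) (∈-options {s} φ) l)
    (∈-map⁺ (map₁ (a ∷_)) (∈-completions ρ le))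

completions-sound : ∀ s σ {w t} → (w , t) ∈ completions s σ → Run s w t × σ ⊑ w
completions-sound s []      (here refl) = [] , []
completions-sound s (c ∷ σ) p
  with a , a∈ , q ← find (∈-concatMap⁻ (λ a → map (map₁ (a ∷_)) (completions (next s a) σ)) {xs = letters s c} p)
  with (w , t) , q′ , refl ← ∈-map⁻ (map₁ (a ∷_)) q
  with ρ , le ← completions-sound (next s a) σ q′
  with a∈′ , l ← ∈-filter⁻ (c ≼?_) {xs = options s} a∈
  = (options-sound {s} a∈′ ∷ ρ) , (l ∷ le)

submasks : Letter → ℕ → List Letter
submasks a k = filter (λ c → (c ≼? a) ×-dec (size c ≤? k)) triples

-- The number `k` is the weight still available; spending it letter by letter keeps the enumeration
-- small.
masks : Word → ℕ → List Word
masks []      k = [ [] ]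
masks (a ∷ w) k = concatMap (λ c → map (c ∷_) (masks w (k ∸ size c))) (submasks a k)

∈-masks : ∀ {σ w} → σ ⊑ w → ∀ {k} → weight σ ≤ k → σ ∈ masks w k
∈-masks []                        le = here refl
∈-masks {c ∷ σ} {a ∷ w} (l ∷ ls) {k} le =
  ∈-concatMap (λ c → map (c ∷_) (masks w (k ∸ size c))) {xs = submasks a k}
    (∈-filter⁺ (λ c → (c ≼? a) ×-dec (size c ≤? k)) (∈-triples c) (l , ≤-trans (m≤m+n (size c) _) le))
    (∈-map⁺ (c ∷_) (∈-masks ls (m+n≤o⇒n≤o∸m (size c) le)))
  where
  m+n≤o⇒n≤o∸m : ∀ m {n o} → m + n ≤ o → n ≤ o ∸ m
  m+n≤o⇒n≤o∸m m {n} le = ≤-trans (≤-reflexive (sym (m+n∸m≡n m n))) (∸-monoˡ-≤ m le)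

masks-sound : ∀ w k {σ} → σ ∈ masks w k → σ ⊑ w × weight σ ≤ k
masks-sound []      k (here refl) = [] , z≤n
masks-sound (a ∷ w) k p
  with c , c∈ , q ← find (∈-concatMap⁻ (λ c → map (c ∷_) (masks w (k ∸ size c))) {xs = submasks a k} p)
  with σ , q′ , refl ← ∈-map⁻ (c ∷_) q
  with ls , wt ← masks-sound w (k ∸ size c) q′
  with _ , l , sz ← ∈-filter⁻ (λ c → (c ≼? a) ×-dec (size c ≤? k)) {xs = triples} c∈
  = (l ∷ ls) , ≤-trans (+-monoʳ-≤ (size c) wt) (≤-reflexive (m+[n∸m]≡n sz))

forces? : ∀ σ w → Dec (Forces σ w)
forces? σ w = (σ ⊑? w) ×-dec map′ to from
  (all? (λ s → all? (λ (w′ , t) → triple-≟ t s →-dec word-≟ w′ w) (completions s σ)) triples)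
  where
  to : All (λ s → All (λ (w′ , t) → t ≡ s → w′ ≡ w) (completions s σ)) triples →
       ∀ w′ → Closed w′ → σ ⊑ w′ → w′ ≡ w
  to al w′ (s , ρ) le = All.lookup (All.lookup al (∈-triples s)) (∈-completions ρ le) refl
  from : (∀ w′ → Closed w′ → σ ⊑ w′ → w′ ≡ w) →
         All (λ s → All (λ (w′ , t) → t ≡ s → w′ ≡ w) (completions s σ)) triples
  from f = All.tabulate λ {s} _ → All.tabulate λ {(w′ , t)} q eq →
    let ρ , le = completions-sound s σ q in f w′ (s , subst (Run s w′) eq ρ) le

forceable? : ∀ w k → Dec (Forceable w k)
forceable? w k = map′ to from (any? (λ σ → forces? σ w) (masks w k))
  where
  to : Any (λ σ → Forces σ w) (masks w k) → Forceable w k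
  to p = let σ , σ∈ , fs = find p in σ , fs , proj₂ (masks-sound w k σ∈)
  from : Forceable w k → Any (λ σ → Forces σ w) (masks w k)
  from (σ , fs , wt) = lose (∈-masks (proj₁ fs) wt) fs

dominates? : ∀ σA σB A B → Dec (Dominates σA σB A B)
dominates? σA σB A B = map′ to from
  (all? (λ s → all? (λ (w , t) →
     any? (λ (w′ , t′) → triple-≟ t′ t ×-dec (word-≟ w′ A →-dec word-≟ w B)) (completions s σA))
     (completions s σB)) triples)
  where
  Check : Set
  Check = All (λ s → All (λ (w , t) →
    Any (λ (w′ , t′) → t′ ≡ t × (w′ ≡ A → w ≡ B)) (completions s σA)) (completions s σB)) triples
  to : Check → Dominates σA σB A B
  to al s t w ρ le with find (All.lookup (All.lookup al (∈-triples s)) (∈-completions ρ le))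
  ... | (w′ , _) , q , refl , back = let ρ′ , le′ = completions-sound s σA q in w′ , ρ′ , le′ , back
  from : Dominates σA σB A B → Check
  from dom = All.tabulate λ {s} _ → All.tabulate λ {(w , t)} q →
    let ρ , le = completions-sound s σB q
        w′ , ρ′ , le′ , back = dom s t w ρ le
    in lose (∈-completions ρ′ le′) (refl , back)

-- Tiles and local exchanges

data Tile : Set where
  three four : Tile

∅ᴸ uᴸ sᴸ vᴸ uvᴸ : Letter
∅ᴸ  = false , false , false
uᴸ  = true  , false , false
sᴸ  = false , true  , false
vᴸ  = false , false , true
uvᴸ = true  , false , true

tile : Tile → Word
tile three = vᴸ ∷ uᴸ ∷ sᴸ ∷ []
tile four  = vᴸ ∷ uᴸ ∷ uvᴸ ∷ ∅ᴸ ∷ []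

word : List Tile → Word
word = concatMap tile

mark : ℕ → List (Letter × ℕ) → Word
mark L = foldr (λ (a , i) → add a i) (replicate L ∅ᴸ)
  where
  add : Letter → ℕ → Word → Word
  add _           _       []                  = []
  add (u , s , v) zero    ((u′ , s′ , v′) ∷ w) = (u ∨ u′ , s ∨ s′ , v ∨ v′) ∷ w
  add a           (suc i) (b ∷ w)             = b ∷ add a i w

Candidate : (σA A B σB : Word) → Set
Candidate σA A B σB = σB ⊑ B × weight σB ≤ suc (weight σA) × Dominates σA σB A B

candidate? : ∀ σA A B σB → Dec (Candidate σA A B σB)
candidate? σA A B σB = (σB ⊑? B) ×-dec (weight σB ≤? suc (weight σA)) ×-dec dominates? σA σB A B

-- A word above the full mask `A` is above every σA, so a single σB serves all σA of weight more
-- than `c`. The lightest of these weighs `c` + 1, which allows σB the weight `c` + 2.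
Heavy : ℕ → (A B σB : Word) → Set
Heavy c A B σB = σB ⊑ B × weight σB ≤ suc (suc c) × Dominates A σB A B

heavy? : ∀ c A B σB → Dec (Heavy c A B σB)
heavy? c A B σB = (σB ⊑? B) ×-dec (weight σB ≤? suc (suc c)) ×-dec dominates? A σB A B

Replaceable-heavy : ∀ {c A B σB σA} → Heavy c A B σB → σA ⊑ A → c < weight σA → Replaceable σA A B
Replaceable-heavy (σB⊑B , wt , dom) σA⊑A c<wt = _ , σB⊑B , ≤-trans wt (s≤s c<wt) ,
  λ s t w ρ le → let w′ , ρ′ , le′ , back = dom s t w ρ le in w′ , ρ′ , ⊑-trans σA⊑A le′ , back

Replaceable-cases⊎ : ∀ {A B C} c (bs cs : List Word) {σB} → Heavy c A B σB →
  All (λ σA → Any (Candidate σA A B) bs ⊎ Any (Candidate σA A C) cs) (masks A c) →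
  ∀ σA → σA ⊑ A → Replaceable σA A B ⊎ Replaceable σA A C
Replaceable-cases⊎ c bs cs hv al σA σA⊑A with weight σA ≤? c
... | yes wt = Sum.map (λ p → let σ , _ , x = find p in σ , x) (λ p → let σ , _ , x = find p in σ , x)
                 (All.lookup al (∈-masks σA⊑A wt))
... | no ¬wt = inj₁ (Replaceable-heavy hv σA⊑A (≰⇒> ¬wt))

light? : ∀ A B c bs → Dec (All (λ σA → Any (Candidate σA A B) bs) (masks A c))
light? A B c bs = all? (λ σA → any? (candidate? σA A B) bs) (masks A c)

Replaceable-light : ∀ A B c (bs : List Word) → {True (light? A B c bs)} →
  ∀ σA → σA ⊑ A → weight σA ≤ c → Replaceable σA A B
Replaceable-light A B c bs {al} σA σA⊑A wt =
  let σ , _ , x = find (All.lookup (toWitness al) (∈-masks σA⊑A wt)) in σ , x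

-- The mask σU serves all σA of weight above c, the candidates bs serve the others.
certify : ∀ A B c σU bs → {True (heavy? c A B σU)} → {True (light? A B c bs)} →
  ∀ r {k} → Forceable (A ++ r) k →
    Forceable (B ++ r) (suc k)
certify A B c σU bs {hv} {al} = Forceable-replace λ σA σA⊑A → cases σA σA⊑A (weight σA ≤? c)
  where
  cases : ∀ σA → σA ⊑ A → Dec (weight σA ≤ c) → Replaceable σA A B
  cases σA σA⊑A (yes wt) = Replaceable-light A B c bs {al} σA σA⊑A wt
  cases σA σA⊑A (no ¬wt) = Replaceable-heavy (toWitness hv) σA⊑A (≰⇒> ¬wt)

certify⊎ : ∀ A B C c σU bs cs → {True (heavy? c A B σU)} →
  {True (all? (λ σA → any? (candidate? σA A B) bs ⊎-dec any? (candidate? σA A C) cs) (masks A c))} →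
  ∀ r {k} → Forceable (A ++ r) k →
    Forceable (B ++ r) (suc k) ⊎ Forceable (C ++ r) (suc k)
certify⊎ A B C c σU bs cs {hv} {al} =
  Forceable-replace⊎ (Replaceable-cases⊎ c bs cs (toWitness hv) (toWitness al))

-- The candidate lists come from a computer search. Unfolding these proofs in later
-- conversion checks would be prohibitively slow.
abstract

  34→43 : ∀ r {k} → Forceable (word (three ∷ four ∷ []) ++ r) k →
    Forceable (word (four ∷ three ∷ []) ++ r) (suc k)
  34→43 = certify (word (three ∷ four ∷ [])) (word (four ∷ three ∷ [])) 1
    (mark 7 ((sᴸ , 6) ∷ (uᴸ , 1) ∷ (uᴸ , 5) ∷ []))
    (mark 7 ((sᴸ , 6) ∷ (uᴸ , 1) ∷ []) ∷ mark 7 ((uᴸ , 5) ∷ []) ∷ mark 7 ((uᴸ , 1) ∷ (vᴸ , 0) ∷ []) ∷ [])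

  -- Here the window must contain the letters v u with which the next tile begins.
  43→34 : ∀ r {k} → Forceable (word (four ∷ three ∷ []) ++ vᴸ ∷ uᴸ ∷ r) k →
    Forceable (word (three ∷ four ∷ []) ++ vᴸ ∷ uᴸ ∷ r) (suc k)
  43→34 = certify (word (four ∷ three ∷ []) ++ vᴸ ∷ uᴸ ∷ []) (word (three ∷ four ∷ []) ++ vᴸ ∷ uᴸ ∷ []) 1
    (mark 9 ((sᴸ , 2) ∷ (uᴸ , 1) ∷ (uᴸ , 5) ∷ []))
    (mark 9 ((sᴸ , 2) ∷ (vᴸ , 7) ∷ []) ∷ mark 9 ((uᴸ , 8) ∷ []) ∷
     mark 9 ((uᴸ , 1) ∷ (vᴸ , 0) ∷ []) ∷ mark 9 ((uᴸ , 5) ∷ (vᴸ , 3) ∷ []) ∷ [])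

  -- Both windows have length 12, and in this direction the check succeeds without any neighbouring
  -- tile.
  444→3333 : ∀ r {k} → Forceable (word (replicate 3 four) ++ r) k →
    Forceable (word (replicate 4 three) ++ r) (suc k)
  444→3333 = certify (word (replicate 3 four)) (word (replicate 4 three)) 1
    (mark 12 ((sᴸ , 2) ∷ (sᴸ , 11) ∷ (uᴸ , 1) ∷ []))
    (mark 12 ((sᴸ , 11) ∷ (vᴸ , 0) ∷ []) ∷ mark 12 ((uᴸ , 1) ∷ []) ∷ mark 12 ((sᴸ , 8) ∷ (uᴸ , 7) ∷ []) ∷ [])

  -- The exchange of 3333 for 444, in a window enlarged by a neighbouring `four`. Words made of
  -- threes alone are left to the window 33333.
  43333→4444 : ∀ r {k} → Forceable (word (four ∷ replicate 4 three) ++ r) k →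
    Forceable (word (replicate 4 four) ++ r) (suc k)
  43333→4444 = certify (word (four ∷ replicate 4 three)) (word (replicate 4 four)) 2
    (mark 16 ((uᴸ , 1) ∷ (uᴸ , 6) ∷ (uᴸ , 14) ∷ (vᴸ , 4) ∷ []))
    ( mark 16 ((uᴸ , 1) ∷ (vᴸ , 2) ∷ (vᴸ , 14) ∷ []) ∷
      mark 16 ((uᴸ , 9) ∷ (uᴸ , 14) ∷ (vᴸ , 12) ∷ []) ∷
      mark 16 ((uᴸ , 14) ∷ (vᴸ , 0) ∷ []) ∷
      mark 16 ((uᴸ , 2) ∷ (uᴸ , 13) ∷ (vᴸ , 14) ∷ []) ∷
      mark 16 ((uᴸ , 1) ∷ (uᴸ , 6) ∷ (uᴸ , 14) ∷ []) ∷
      mark 16 ((uᴸ , 13) ∷ (vᴸ , 14) ∷ []) ∷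
      mark 16 ((uᴸ , 1) ∷ (uᴸ , 13) ∷ (vᴸ , 4) ∷ []) ∷
      mark 16 ((uᴸ , 1) ∷ []) ∷
      mark 16 ((uᴸ , 1) ∷ (uᴸ , 6) ∷ (vᴸ , 4) ∷ []) ∷
      mark 16 ((uᴸ , 2) ∷ (uᴸ , 6) ∷ []) ∷
      mark 16 ((uᴸ , 1) ∷ (uᴸ , 13) ∷ (vᴸ , 14) ∷ []) ∷
      mark 16 ((uᴸ , 13) ∷ (vᴸ , 0) ∷ (vᴸ , 14) ∷ []) ∷
      mark 16 ((uᴸ , 13) ∷ (vᴸ , 2) ∷ (vᴸ , 14) ∷ []) ∷ [])

  -- No mask of 4443 of weight 3 dominates the mask {uu₄, spoke₅} of 33333; for that
  -- one the block 444 is moved to the other end.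
  33333→4443⊎3444 : ∀ r {k} → Forceable (word (replicate 5 three) ++ r) k →
    Forceable (word (four ∷ four ∷ four ∷ three ∷ []) ++ r) (suc k) ⊎
    Forceable (word (three ∷ four ∷ four ∷ four ∷ []) ++ r) (suc k)
  33333→4443⊎3444 = certify⊎ (word (replicate 5 three))
    (word (four ∷ four ∷ four ∷ three ∷ [])) (word (three ∷ four ∷ four ∷ four ∷ [])) 2
    (mark 15 ((sᴸ , 14) ∷ (uᴸ , 1) ∷ (uᴸ , 2) ∷ (uᴸ , 13) ∷ []))
    ( mark 15 ((sᴸ , 14) ∷ (uᴸ , 5) ∷ (vᴸ , 2) ∷ []) ∷
      mark 15 ((uᴸ , 9) ∷ (vᴸ , 12) ∷ []) ∷
      mark 15 ((sᴸ , 14) ∷ (uᴸ , 13) ∷ (vᴸ , 2) ∷ []) ∷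
      mark 15 ((uᴸ , 2) ∷ (vᴸ , 0) ∷ []) ∷
      mark 15 ((sᴸ , 14) ∷ []) ∷
      mark 15 ((uᴸ , 1) ∷ (uᴸ , 9) ∷ (vᴸ , 12) ∷ []) ∷
      mark 15 ((uᴸ , 1) ∷ (vᴸ , 10) ∷ []) ∷
      mark 15 ((uᴸ , 10) ∷ (vᴸ , 2) ∷ []) ∷
      mark 15 ((uᴸ , 1) ∷ (uᴸ , 2) ∷ (vᴸ , 0) ∷ []) ∷
      mark 15 ((uᴸ , 1) ∷ (uᴸ , 13) ∷ (vᴸ , 4) ∷ []) ∷ [])
    (mark 15 ((sᴸ , 2) ∷ (uᴸ , 1) ∷ (uᴸ , 5) ∷ []) ∷ [])

  -- Without a neighbouring tile (n = 12) two masks of weight 2 resist the exchange,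
  -- but 444 itself has a forcing mask of weight 3.
  3333→444-light : ∀ σ → σ ⊑ word (replicate 4 three) → weight σ ≤ 1 →
    Replaceable σ (word (replicate 4 three)) (word (replicate 3 four))
  3333→444-light = Replaceable-light (word (replicate 4 three)) (word (replicate 3 four)) 1
    ( mark 12 ((uᴸ , 5) ∷ (vᴸ , 2) ∷ []) ∷
      mark 12 ((uᴸ , 9) ∷ (vᴸ , 10) ∷ []) ∷
      mark 12 ((uᴸ , 10) ∷ []) ∷
      mark 12 ((uᴸ , 1) ∷ (vᴸ , 10) ∷ []) ∷
      mark 12 ((uᴸ , 10) ∷ (vᴸ , 2) ∷ []) ∷ [])

  444-forceable : Forceable (word (replicate 3 four)) 3
  444-forceable = σ , from-yes (forces? σ (word (replicate 3 four))) , ≤-refl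
    where
    σ : Word
    σ = mark 12 ((uᴸ , 1) ∷ (uᴸ , 2) ∷ (vᴸ , 0) ∷ [])

  3333→444 : ∀ {k} → Forceable (word (replicate 4 three)) k → Forceable (word (replicate 3 four)) (suc k)
  3333→444 {k} (σ , fs , le) = cases (weight σ ≤? 1)
    where
    replace : Replaceable σ (word (replicate 4 three)) (word (replicate 3 four)) →
              Forceable (word (replicate 3 four)) (suc k)
    replace (σ′ , σ′⊑ , wt′ , dom) = σ′ ,
      subst (λ τ → Forces τ _) (List.++-identityʳ σ′)
        (Forces-replace {σ = []} {r = []} (proj₁ fs) σ′⊑ dom Pointwise.[]
          (subst (λ τ → Forces τ _) (sym (List.++-identityʳ σ)) fs)) ,
      ≤-trans wt′ (s≤s le)
    cases : Dec (weight σ ≤ 1) → Forceable (word (replicate 3 four)) (suc k)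
    -- Here `σ` weighs at least 2, so `suc k` is at least 3 and the fixed mask of weight 3 suffices.
    cases (no ¬wt) = Forceable-mono (s≤s (≤-trans (≰⇒> ¬wt) le)) 444-forceable
    cases (yes wt) = replace (3333→444-light σ (proj₁ fs) wt)

-- Linking the tile words

word-++ : ∀ ts ts′ → word (ts ++ ts′) ≡ word ts ++ word ts′
word-++ = List.concatMap-++ tile

ForceableT : List Tile → ℕ → Set
ForceableT ts = Forceable (word ts)

rotate : ∀ ts ts′ {k} → ForceableT (ts ++ ts′) k → ForceableT (ts′ ++ ts) k
rotate ts ts′ f = subst (λ w → Forceable w _) (sym (word-++ ts′ ts))
  (Forceable-rotate (word ts) (word ts′) (subst (λ w → Forceable w _) (word-++ ts ts′) f))

Near : List Tile → List Tile → Set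
Near ts ts′ = ∀ {k} → ForceableT ts k → ForceableT ts′ (suc k)

-- By rotation the prefix `ps` is moved to the end, the exchange is made at the front, and the
-- prefix is moved back.
Near-prefix : ∀ as bs → (∀ ts → Near (as ++ ts) (bs ++ ts)) → ∀ ps ts → Near (ps ++ as ++ ts) (ps ++ bs ++ ts)
Near-prefix as bs near ps ts {k} f =
  rotate (bs ++ ts) ps (subst (λ ts → ForceableT ts (suc k)) (sym (List.++-assoc bs ts ps))
    (near (ts ++ ps) (subst (λ ts → ForceableT ts k) (List.++-assoc as ts ps) (rotate ps (as ++ ts) f))))

span : List Tile → ℕ
span ts = length (word ts)

span-++ : ∀ ts ts′ → span (ts ++ ts′) ≡ span ts + span ts′
span-++ ts ts′ = trans (cong length (word-++ ts ts′)) (List.length-++ (word ts))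

-- The bound holds both ways, so paths can be reversed. Both ends contain a `three`, so every word
-- on a path has a spoke, and equal spans keep n fixed.
Link : List Tile → List Tile → Set
Link ts ts′ = (Near ts ts′ × Near ts′ ts) × (three ∈ ts × three ∈ ts′) × span ts ≡ span ts′

Link-sym : ∀ {ts ts′} → Link ts ts′ → Link ts′ ts
Link-sym (near , mem , eq) = Product.swap near , Product.swap mem , sym eq

Link-swap : ∀ ps ts → Link (ps ++ three ∷ four ∷ ts) (ps ++ four ∷ three ∷ ts)
Link-swap ps ts =
  ( Near-prefix (three ∷ four ∷ []) (four ∷ three ∷ []) (λ ts → 34→43 (word ts)) ps ts
  , Near-prefix (four ∷ three ∷ []) (three ∷ four ∷ []) near43 ps ts ) ,
  (∈-++⁺ʳ ps (here refl) , ∈-++⁺ʳ ps (there (here refl))) ,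
  trans (span-++ ps _) (sym (span-++ ps _))
  where
  near43 : ∀ ts → Near (four ∷ three ∷ ts) (three ∷ four ∷ ts)
  -- Here the two tiles are the whole cyclic word, and 43 and 34 are rotations of each other.
  near43 []           f = Forceable-mono (n≤1+n _) (rotate (four ∷ []) (three ∷ []) f)
  near43 (three ∷ ts) f = 43→34 (sᴸ ∷ word ts) f
  near43 (four ∷ ts)  f = 43→34 (uvᴸ ∷ ∅ᴸ ∷ word ts) f

-- Adjacent transpositions generate all rearrangements. The claim is made for every prefix because
-- `prep` moves a tile into it.
↭⇒Link* : ∀ {ts ts′} → ts ↭ ts′ → ∀ ps → Star Link (ps ++ ts) (ps ++ ts′)
↭⇒Link* Perm.refl          ps = ε
↭⇒Link* (Perm.prep t p)    ps = subst₂ (Star Link) (List.++-assoc ps _ _) (List.++-assoc ps _ _) (↭⇒Link* p (ps ++ [ t ]))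
↭⇒Link* (Perm.trans p q)   ps = ↭⇒Link* p ps ◅◅ ↭⇒Link* q ps
↭⇒Link* (Perm.swap {ts} {ts′} t t′ p) ps = swapped t t′ ◅◅
  subst₂ (Star Link) (List.++-assoc ps _ _) (List.++-assoc ps _ _) (↭⇒Link* p (ps ++ t′ ∷ t ∷ []))
  where
  swapped : ∀ t t′ → Star Link (ps ++ t ∷ t′ ∷ ts) (ps ++ t′ ∷ t ∷ ts)
  swapped three three = ε
  swapped four  four  = ε
  swapped three four  = Link-swap ps ts ◅ ε
  swapped four  three = Link-sym (Link-swap ps ts) ◅ ε

Link*-span : ∀ {ts ts′} → Star Link ts ts′ → span ts ≡ span ts′
Link*-span ε                  = refl
Link*-span ((_ , _ , eq) ◅ p) = trans eq (Link*-span p)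

-- Discrete intermediate value theorem along a path of links.
crossing : ∀ {ts ts′} → Star Link ts ts′ → three ∈ ts → ∀ s → ForceableT ts (suc s) → ¬ ForceableT ts′ s →
           ∃[ z ] three ∈ z × span z ≡ span ts × ForceableT z (suc s) × ¬ ForceableT z s
crossing ε 3∈ s f ¬f = _ , 3∈ , refl , f , ¬f
crossing {ts} (((near , _) , (_ , 3∈′) , eq) ◅ p) 3∈ s f ¬f with forceable? (word ts) s
... | no ¬g = _ , 3∈ , refl , f , ¬g
... | yes g = let z , 3∈z , eq′ , x = crossing p 3∈′ s (near g) ¬f in z , 3∈z , trans eq′ (sym eq) , x

sorted : ℕ → ℕ → List Tile
sorted m b = replicate m three ++ replicate b four

↭-sorted : ∀ ts → ∃₂ λ m b → ts ↭ sorted m b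
↭-sorted []           = 0 , 0 , ↭-refl
↭-sorted (three ∷ ts) = let m , b , p = ↭-sorted ts in suc m , b , Perm.prep three p
↭-sorted (four ∷ ts)  = let m , b , p = ↭-sorted ts in
  m , suc b , ↭-trans (Perm.prep four p) (↭-sym (shift four (replicate m three) (replicate b four)))

fours-sorted : ∀ j m b → replicate j four ++ sorted m b ↭ sorted m (j + b)
fours-sorted zero    m b = ↭-refl
fours-sorted (suc j) m b = ↭-trans (Perm.prep four (fours-sorted j m b))
  (↭-sym (shift four (replicate m three) (replicate (j + b) four)))

span-sorted : ∀ m b → span (sorted m b) ≡ m * 3 + b * 4
span-sorted zero    zero    = refl
span-sorted zero    (suc b) = cong (4 +_) (span-sorted zero b)
span-sorted (suc m) b       = cong (3 +_) (span-sorted m b)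

snoc-replicate : ∀ {A : Set} (x : A) m → replicate m x ++ [ x ] ≡ x ∷ replicate m x
snoc-replicate x zero    = refl
snoc-replicate x (suc m) = cong (x ∷_) (snoc-replicate x m)

-- At least one `three` survives, as a link demands. If there is a `four`, it is brought to the
-- front as the neighbour of 3333; otherwise the fifth `three` is the neighbour.
3⁴→4³ : ∀ m b → Star Link (sorted (5 + m) b) (sorted (1 + m) (3 + b))
3⁴→4³ m (suc b) =
  ↭⇒Link* (shift four (replicate (5 + m) three) (replicate b four)) [] ◅◅
  link ◅ ↭⇒Link* (fours-sorted 4 (1 + m) b) []
  where
  ts = sorted (1 + m) b
  link : Link (four ∷ replicate 4 three ++ ts) (replicate 4 four ++ ts)
  link = (43333→4444 (word ts) ,
          Near-prefix (replicate 3 four) (replicate 4 three) (λ ts → 444→3333 (word ts)) (four ∷ []) ts) ,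
         (there (here refl) , there (there (there (there (here refl))))) , refl
3⁴→4³ m zero = link ◅ ↭⇒Link* (fours-sorted 3 (1 + m) 0) []
  where
  ts = sorted m 0
  rotated : (replicate 3 four ++ ts) ++ [ three ] ≡ replicate 3 four ++ three ∷ ts
  rotated = cong (replicate 3 four ++_)
    (trans (cong (_++ [ three ]) (List.++-identityʳ (replicate m three)))
      (trans (snoc-replicate three m) (cong (three ∷_) (sym (List.++-identityʳ (replicate m three))))))
  forth : Near (replicate 5 three ++ ts) (replicate 3 four ++ three ∷ ts)
  forth {k} f with 33333→4443⊎3444 (word ts) f
  ... | inj₁ g = g
  -- The outcome is 3444 followed by threes only, which becomes 4443 followed by those threes on
  -- rotating the first tile to the end.
  ... | inj₂ g = subst (λ ts → ForceableT ts (suc k)) rotated (rotate [ three ] (replicate 3 four ++ ts) g)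
  link : Link (replicate 5 three ++ ts) (replicate 3 four ++ three ∷ ts)
  link = (forth , 444→3333 (word (three ∷ ts))) ,
         (here refl , there (there (there (here refl)))) , refl

-- The number of threes is reduced modulo 4 to one of 1, 2, 3, 4, and not to 0, so that the normal
-- form still contains a `three`.
reduce : ∀ m b → ∃₂ λ (r : Fin 4) b′ → Star Link (sorted (suc m) b) (sorted (suc (toℕ r)) b′)
reduce 0 b = zero , b , ε
reduce 1 b = suc zero , b , ε
reduce 2 b = suc (suc zero) , b , ε
reduce 3 b = suc (suc (suc zero)) , b , ε
reduce (suc (suc (suc (suc m)))) b = let r , b′ , p = reduce m (3 + b) in r , b′ , 3⁴→4³ m b ◅◅ p

normalise : ∀ {ts} → three ∈ ts → ∃₂ λ (r : Fin 4) b → Star Link ts (sorted (suc (toℕ r)) b)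
normalise {ts} 3∈ with ↭-sorted ts
... | suc m , b , p = let r , b′ , q = reduce m b in r , b′ , ↭⇒Link* p [] ◅◅ q
... | zero  , b , p = contradiction (∈-resp-↭ p 3∈) (3∉ b)
  where
  3∉ : ∀ b → three ∉ replicate b four
  3∉ (suc b) (there q) = 3∉ b q

residue : ∀ {m b m′ b′} → m * 3 + b * 4 ≡ m′ * 3 + b′ * 4 → m * 3 % 4 ≡ m′ * 3 % 4
residue {m} {b} {m′} {b′} eq = trans (sym ([m+kn]%n≡m%n (m * 3) b 4))
  (trans (cong (_% 4) eq) ([m+kn]%n≡m%n (m′ * 3) b′ 4))

-- Since 3 is invertible modulo 4, the span modulo 4 determines the number of threes in the normal
-- form, and then the span itself determines the number of fours.
connect : ∀ {ts ts′} → three ∈ ts → three ∈ ts′ → span ts ≡ span ts′ → Star Link ts ts′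
connect {ts} {ts′} 3∈ 3∈′ eq with normalise 3∈ | normalise 3∈′
... | r , b , p | r′ , b′ , p′ = meet (injective r r′ (residue {suc (toℕ r)} {b} {suc (toℕ r′)} {b′} total)) p p′ total
  where
  injective : ∀ (r r′ : Fin 4) → suc (toℕ r) * 3 % 4 ≡ suc (toℕ r′) * 3 % 4 → r ≡ r′
  injective = from-yes (Fin.all? {n = 4} λ r → Fin.all? {n = 4} λ r′ →
    (suc (toℕ r) * 3 % 4 ≟ suc (toℕ r′) * 3 % 4) →-dec (r Fin.≟ r′))
  total : suc (toℕ r) * 3 + b * 4 ≡ suc (toℕ r′) * 3 + b′ * 4
  total = trans (sym (span-sorted (suc (toℕ r)) b)) (trans (sym (Link*-span p))
    (trans eq (trans (Link*-span p′) (span-sorted (suc (toℕ r′)) b′))))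
  meet : r ≡ r′ → Star Link ts (sorted (suc (toℕ r)) b) → Star Link ts′ (sorted (suc (toℕ r′)) b′) →
         suc (toℕ r) * 3 + b * 4 ≡ suc (toℕ r′) * 3 + b′ * 4 → Star Link ts ts′
  meet refl q q′ tot with *-cancelʳ-≡ b b′ 4 (+-cancelˡ-≡ (suc (toℕ r) * 3) _ _ tot)
  ... | refl = q ◅◅ reverse Link-sym q′

-- The word 4...4 and intermediate values

three∈⊎fours : ∀ ts → three ∈ ts ⊎ ∃[ k ] ts ≡ replicate k four
three∈⊎fours []           = inj₂ (0 , refl)
three∈⊎fours (three ∷ ts) = inj₁ (here refl)
three∈⊎fours (four ∷ ts)  = Sum.map there (λ (k , eq) → suc k , cong (four ∷_) eq) (three∈⊎fours ts)

fours-near : ∀ j → Near (replicate (3 + j) four) (sorted 4 j) × Near (sorted 4 j) (replicate (3 + j) four)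
fours-near j = 444→3333 (word (replicate j four)) , back j
  where
  back : ∀ j → Near (sorted 4 j) (replicate (3 + j) four)
  -- For j = 0 there is no further tile, and n = 12; otherwise the last `four` is rotated to the
  -- front as a neighbour.
  back zero    f = 3333→444 f
  back (suc i) f = 43333→4444 (word (replicate i four))
    (rotate (sorted 4 i) [ four ]
      (subst (λ ts → ForceableT (replicate 4 three ++ ts) _) (sym (snoc-replicate four i)) f))

span-fours : ∀ k → span (replicate k four) ≡ k * 4
span-fours = span-sorted 0

-- A span divisible by 4 needs a number of threes divisible by 4, so the normal form has exactly
-- four of them and is one exchange away from 4...4.
fours-normalise : ∀ {ts k} → three ∈ ts → span ts ≡ span (replicate k four) →
                  ∃[ j ] k ≡ 3 + j × Star Link ts (sorted 4 j)
fours-normalise {ts} {k} 3∈ eq with normalise 3∈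
... | r , b , p = meet r p (trans (sym (span-sorted (suc (toℕ r)) b)) (trans (sym (Link*-span p)) (trans eq (span-fours k))))
  where
  meet : ∀ r → Star Link ts (sorted (suc (toℕ r)) b) → suc (toℕ r) * 3 + b * 4 ≡ k * 4 →
         ∃[ j ] k ≡ 3 + j × Star Link ts (sorted 4 j)
  meet (suc (suc (suc zero))) q tot = b , sym (*-cancelʳ-≡ (3 + b) k 4 tot) , q
  meet zero                   q tot = contradiction (residue {1} {b} {0} {k} tot) λ ()
  meet (suc zero)             q tot = contradiction (residue {2} {b} {0} {k} tot) λ ()
  meet (suc (suc zero))       q tot = contradiction (residue {3} {b} {0} {k} tot) λ ()

-- The values are at most `s` at one end and at least `s` + 2 at the other, while `crossing` asks
-- only for at most `s` + 1 and at least `s` + 1. This slack of one allows an end 4...4 to be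
-- replaced by its neighbour `sorted 4 j`.
between : ∀ {ts ts′} s → span ts ≡ span ts′ → ForceableT ts s → ¬ ForceableT ts′ (suc s) →
          ∃[ z ] three ∈ z × span z ≡ span ts × ForceableT z (suc s) × ¬ ForceableT z s
between {ts} {ts′} s eq f ¬f with three∈⊎fours ts | three∈⊎fours ts′
... | inj₁ 3∈ | inj₁ 3∈′ =
  crossing (connect 3∈ 3∈′ eq) 3∈ s (Forceable-mono (n≤1+n s) f) (¬f ∘ Forceable-mono (n≤1+n s))
... | inj₁ 3∈ | inj₂ (k , refl) with fours-normalise {k = k} 3∈ eq
...   | j , refl , p = crossing p 3∈ s (Forceable-mono (n≤1+n s) f) (λ g → ¬f (proj₂ (fours-near j) g))
between {ts} {ts′} s eq f ¬f | inj₂ (k , refl) | inj₁ 3∈′ with fours-normalise {k = k} 3∈′ (sym eq)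
...   | j , refl , p =
  let z , 3∈ , eq′ , x = crossing (reverse Link-sym p) (here refl) s (proj₁ (fours-near j) f) (¬f ∘ Forceable-mono (n≤1+n s))
  in z , 3∈ , trans eq′ (trans (sym (Link*-span p)) (sym eq)) , x
between {ts} {ts′} s eq f ¬f | inj₂ (k , refl) | inj₂ (k′ , refl)
  with *-cancelʳ-≡ k k′ 4 (trans (sym (span-fours k)) (trans eq (span-fours k′)))
... | refl = contradiction (Forceable-mono (n≤1+n s) f) ¬f

-- Letters of a matching

data Kind : Set where
  uuᴷ spokeᴷ vvᴷ : Kind

kinds : List Kind
kinds = uuᴷ ∷ spokeᴷ ∷ vvᴷ ∷ []

has : Letter → Kind → Bool
has (u , _ , _) uuᴷ    = u
has (_ , s , _) spokeᴷ = s
has (_ , _ , v) vvᴷ    = v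

true-iff : ∀ {a b} → (a ≡ true → b ≡ true) → (b ≡ true → a ≡ true) → a ≡ b
true-iff {false} {false} f g = refl
true-iff {false} {true}  f g = g refl
true-iff {true}  {_}     f g = sym (f refl)

letter-ext : ∀ {a b} → (∀ k → has a k ≡ true → has b k ≡ true) → (∀ k → has b k ≡ true → has a k ≡ true) → a ≡ b
letter-ext f g = cong₂ _,_ (true-iff (f uuᴷ) (g uuᴷ))
  (cong₂ _,_ (true-iff (f spokeᴷ) (g spokeᴷ)) (true-iff (f vvᴷ) (g vvᴷ)))

≤-intro : ∀ {a b} → (a ≡ true → b ≡ true) → a Bool.≤ b
≤-intro {false} {false} f = b≤b
≤-intro {false} {true}  f = f≤t
≤-intro {true}  {b}     f rewrite f refl = b≤b

≤-elim : ∀ {a b} → a Bool.≤ b → a ≡ true → b ≡ true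
≤-elim b≤b eq = eq

≼-intro : ∀ {a b} → (∀ k → has a k ≡ true → has b k ≡ true) → a ≼ b
≼-intro f = ≤-intro (f uuᴷ) , ≤-intro (f spokeᴷ) , ≤-intro (f vvᴷ)

≼-elim : ∀ {a b} → a ≼ b → ∀ k → has a k ≡ true → has b k ≡ true
≼-elim (p , _ , _) uuᴷ    = ≤-elim p
≼-elim (_ , p , _) spokeᴷ = ≤-elim p
≼-elim (_ , _ , p) vvᴷ    = ≤-elim p

one-intro : ∀ {a b c} → a ≡ true ⊎ b ≡ true ⊎ c ≡ true →
            ¬ (a ≡ true × b ≡ true) → ¬ (a ≡ true × c ≡ true) → ¬ (b ≡ true × c ≡ true) → one a b c ≡ true
one-intro {true}  {true}  {_}     _ ab ac bc = contradiction (refl , refl) ab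
one-intro {true}  {false} {true}  _ ab ac bc = contradiction (refl , refl) ac
one-intro {true}  {false} {false} _ ab ac bc = refl
one-intro {false} {true}  {true}  _ ab ac bc = contradiction (refl , refl) bc
one-intro {false} {true}  {false} _ ab ac bc = refl
one-intro {false} {false} {true}  _ ab ac bc = refl
one-intro {false} {false} {false} (inj₂ (inj₁ ())) ab ac bc
one-intro {false} {false} {false} (inj₂ (inj₂ ())) ab ac bc

-- Words are read with junk value ∅ᴸ beyond their end.
nth : Word → ℕ → Letter
nth []      _       = ∅ᴸ
nth (a ∷ w) zero    = a
nth (a ∷ w) (suc i) = nth w i

nth-∅ : ∀ i k → has (nth [] i) k ≢ true
nth-∅ i uuᴷ    ()
nth-∅ i spokeᴷ ()
nth-∅ i vvᴷ    ()

nth-++ˡ : ∀ w {w′ i} → i < length w → nth (w ++ w′) i ≡ nth w i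
nth-++ˡ (a ∷ w) {i = zero}  lt       = refl
nth-++ˡ (a ∷ w) {i = suc i} (s≤s lt) = nth-++ˡ w lt

nth-++ʳ : ∀ w {w′} i → nth (w ++ w′) (length w + i) ≡ nth w′ i
nth-++ʳ []      i = refl
nth-++ʳ (a ∷ w) i = nth-++ʳ w i

nth-ext : ∀ {w w′} → length w ≡ length w′ → (∀ i → i < length w → nth w i ≡ nth w′ i) → w ≡ w′
nth-ext {[]}    {[]}     _  f = refl
nth-ext {a ∷ w} {b ∷ w′} eq f =
  cong₂ _∷_ (f 0 (s≤s z≤n)) (nth-ext (suc-injective eq) λ i lt → f (suc i) (s≤s lt))

nth-mono : ∀ {σ w} → σ ⊑ w → ∀ i → nth σ i ≼ nth w i
nth-mono []       i       = b≤b , b≤b , b≤b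
nth-mono (l ∷ ls) zero    = l
nth-mono (l ∷ ls) (suc i) = nth-mono ls i

-- The vertices uᵢ₊₂ and vᵢ₊₁ are covered exactly once, in terms of the letters
-- at i, i + 1 and i + 2.
Compatible : Letter → Letter → Letter → Set
Compatible a b c = one (has a uuᴷ) (has c spokeᴷ) (has c uuᴷ) ≡ true ×
                   one (has a vvᴷ) (has b spokeᴷ) (has b vvᴷ) ≡ true

Run-local : ∀ {s w t} → Run s w t → ∀ i → 2 + i < length w →
            Compatible (nth w i) (nth w (1 + i)) (nth w (2 + i))
Run-local ((_ ∷ φ ∷ ψ ∷ _)) zero    _        = proj₁ ψ , proj₂ φ
Run-local (_ ∷ ρ)           (suc i) (s≤s lt) = Run-local ρ i lt
Run-local (_ ∷ [])          zero    (s≤s ())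
Run-local (_ ∷ _ ∷ [])      zero    (s≤s (s≤s ()))

-- A state records choices at the two preceding indices only, so the last two letters determine it.
Run-end : ∀ {s s′ w t t′} → 2 ≤ length w → Run s w t → Run s′ w t′ → t ≡ t′
Run-end (s≤s (s≤s _)) (_ ∷ _ ∷ [])    (_ ∷ _ ∷ [])      = refl
Run-end (s≤s (s≤s _)) (_ ∷ ρ@(_ ∷ _ ∷ _)) (_ ∷ ρ′) = Run-end (s≤s (s≤s z≤n)) ρ ρ′

-- The two parities of the number of edges crossing a cut are the two types of
-- perfect matchings; ℳ₂ is the odd one.
Odd : State → Set
Odd (x , p , q) = x xor p xor q ≡ true

-- Two covered vertices, uᵢ and vᵢ, lie between consecutive cuts, so the number of crossing edges
-- keeps its parity.
Odd-next : ∀ s a → Fits s a → Odd s → Odd (next s a)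
Odd-next s a = All.lookup (All.lookup check (∈-triples s)) (∈-triples a)
  where
  odd? : ∀ s → Dec (Odd s)
  odd? (x , p , q) = (x xor p xor q) Bool.≟ true
  check : All (λ s → All (λ a → Fits s a → Odd s → Odd (next s a)) triples) triples
  check = from-yes (all? (λ s → all? (λ a → fits? s a →-dec (odd? s →-dec odd? (next s a))) triples) triples)

-- With uᵢ and vᵢ matched to each other, only uuᵢ₋₁ can cross the cut after index i.
after-spoke : ∀ s a → Fits s a → has a spokeᴷ ≡ true →
              next s a ≡ (false , true , false) ⊎ next s a ≡ (false , false , false)
after-spoke (false , false , true)  (false , true , false) _        _ = inj₁ refl
after-spoke (false , false , false) (false , true , false) _        _ = inj₂ refl
after-spoke (false , false , _)     (false , true , true)  (_ , ()) _
after-spoke (true  , false , _)     (false , true , _)     (_ , ()) _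
after-spoke (_     , false , _)     (true  , true , _)     (() , _) _
after-spoke (_     , true  , _)     (_     , true , _)     (() , _) _

least : ∀ (f : ℕ → Bool) m → f m ≡ true → ∃[ g ] g ≤ m × f g ≡ true × (∀ h → h < g → f h ≡ false)
least f m eq with f 0 in eq₀
least f m       eq | true  = 0 , z≤n , eq₀ , λ _ ()
least f zero    eq | false = contradiction (trans (sym eq) eq₀) λ ()
least f (suc m) eq | false with least (f ∘ suc) m eq
... | g , g≤m , fg , below = suc g , s≤s g≤m , fg , λ where
  zero    _        → eq₀
  (suc h) (s≤s lt) → below h lt

-- Of the two states possible after a spoke this is the odd one; each tile starts and ends in it.
base : State
base = false , true , false

Run-word : ∀ ts → Run base (word ts) base
Run-word []           = []
Run-word (three ∷ ts) = (refl , refl) ∷ (refl , refl) ∷ (refl , refl) ∷ Run-word ts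
Run-word (four ∷ ts)  = (refl , refl) ∷ (refl , refl) ∷ (refl , refl) ∷ (refl , refl) ∷ Run-word ts

-- From `base` the letters v and u are forced. Then either s completes a `three`, or uv follows,
-- forcing ∅ and completing a `four`. The states inside a tile differ from `base`, so the word
-- cannot stop there.
parse : ∀ w → Run base w base → ∃[ ts ] w ≡ word ts
parse [] [] = [] , refl
parse (a ∷ w) (φ ∷ ρ) with ∈-options {base} {a} φ
parse (_ ∷ b ∷ w) (φ ∷ ψ ∷ ρ) | here refl with ∈-options {true , false , false} {b} ψ
parse (_ ∷ _ ∷ c ∷ w) (φ ∷ ψ ∷ χ ∷ ρ) | here refl | here refl with ∈-options {false , false , true} {c} χ
... | here refl = let ts , eq = parse w ρ in three ∷ ts , cong (tile three ++_) eq
parse (_ ∷ _ ∷ c ∷ d ∷ w) (φ ∷ ψ ∷ χ ∷ ω ∷ ρ) | here refl | here refl | there (here refl)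
  with ∈-options {true , true , true} {d} ω
... | here refl = let ts , eq = parse w ρ in four ∷ ts , cong (tile four ++_) eq

spoke-in-word : ∀ {ts} → three ∈ ts → ∃[ i ] has (nth (word ts) i) spokeᴷ ≡ true
spoke-in-word                (here refl) = 2 , refl
spoke-in-word {three ∷ ts} (there p)   = let i , eq = spoke-in-word p in 3 + i , eq
spoke-in-word {four ∷ ts}  (there p)   = let i , eq = spoke-in-word p in 4 + i , eq

-- Congruence modulo n

module _ (n : ℕ) .{{_ : NonZero n}} where

  toℕ-mod : ∀ i → toℕ (i mod n) ≡ i % n
  toℕ-mod i = Fin.toℕ-fromℕ< (m%n<n i n)

  mod⇒% : ∀ {i j} → i mod n ≡ j mod n → i % n ≡ j % n
  mod⇒% {i} {j} eq = trans (sym (toℕ-mod i)) (trans (cong toℕ eq) (toℕ-mod j))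

  %⇒mod : ∀ {i j} → i % n ≡ j % n → i mod n ≡ j mod n
  %⇒mod {i} {j} eq = Fin.toℕ-injective (trans (toℕ-mod i) (trans eq (sym (toℕ-mod j))))

  %-shift : ∀ d {i j} → i % n ≡ j % n → (d + i) % n ≡ (d + j) % n
  %-shift d {i} {j} eq = trans (%-distribˡ-+ d i n)
    (trans (cong (λ z → (d % n + z) % n) eq) (sym (%-distribˡ-+ d j n)))

  -- d + opp d is a multiple of n.
  opp : ℕ → ℕ
  opp d = d * n ∸ d

  opp-cancel : ∀ d i → (opp d + (d + i)) % n ≡ i % n
  opp-cancel d i = trans (cong (_% n) (begin
    d * n ∸ d + (d + i)   ≡⟨ +-assoc (d * n ∸ d) d i ⟨
    d * n ∸ d + d + i     ≡⟨ cong (_+ i) (m∸n+n≡m (m≤m*n d n)) ⟩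
    d * n + i             ≡⟨ +-comm (d * n) i ⟩
    i + d * n             ∎)) ([m+kn]%n≡m%n i d n)
    where open ≡-Reasoning

  %-cancelˡ : ∀ d {i j} → (d + i) % n ≡ (d + j) % n → i % n ≡ j % n
  %-cancelˡ d {i} {j} eq = trans (sym (opp-cancel d i)) (trans (%-shift (opp d) eq) (opp-cancel d j))

  %-reach : ∀ d j → ∃[ i ] i < n × (d + i) % n ≡ j % n
  %-reach d j = (opp d + j) % n , m%n<n _ n , trans (%-shift d (m%n%n≡m%n (opp d + j) n))
    (trans (cong (_% n) (trans (sym (+-assoc d (opp d) j)) (trans (cong (_+ j) (+-comm d (opp d))) (+-assoc (opp d) d j))))
      (opp-cancel d j))

  [n+m]%n : ∀ i → (n + i) % n ≡ i % n
  [n+m]%n i = trans (cong (_% n) (+-comm n i)) ([m+n]%n≡m%n i n)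

-- Finite sets as duplicate-free lists

length-⊆ : ∀ {A : Set} {xs ys : List A} → Unique xs → xs ⊆ ys → length xs ≤ length ys
length-⊆ {xs = []}     []         sub = z≤n
length-⊆ {xs = x ∷ xs} (x∉ ∷ uniq) sub with ∈-∃++ (sub (here refl))
... | ys , zs , refl = ≤-trans (s≤s (length-⊆ uniq sub′)) (≤-reflexive (begin
  suc (length (ys ++ zs))        ≡⟨ cong suc (List.length-++ ys) ⟩
  suc (length ys + length zs)    ≡⟨ +-suc (length ys) (length zs) ⟨
  length ys + length (x ∷ zs)    ≡⟨ List.length-++ ys ⟨
  length (ys ++ x ∷ zs)          ∎))
  where
  open ≡-Reasoning
  sub′ : xs ⊆ ys ++ zs
  sub′ {y} y∈ with ∈-++⁻ ys (sub (there y∈))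
  ... | inj₁ p         = ∈-++⁺ˡ p
  ... | inj₂ (there p) = ∈-++⁺ʳ ys p
  ... | inj₂ (here y≡x) = contradiction (sym y≡x) (All.lookup x∉ y∈)

∈-pair⁻ : ∀ {N} {x y z : Fin N} → x ∈ᵥ ｛ y , z ｝ → x ≡ y ⊎ x ≡ z
∈-pair⁻ {y = y} {z} = Sum.map (x∈⁅y⁆⇒x≡y y) (x∈⁅y⁆⇒x≡y z) ∘ x∈p∪q⁻ _ _

∈-pairˡ : ∀ {N} (x y : Fin N) → x ∈ᵥ ｛ x , y ｝
∈-pairˡ x y = x∈p∪q⁺ (inj₁ (x∈⁅x⁆ x))

∈-pairʳ : ∀ {N} (x y : Fin N) → y ∈ᵥ ｛ x , y ｝
∈-pairʳ x y = x∈p∪q⁺ (inj₂ (x∈⁅x⁆ y))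

pair-injective : ∀ {N} {x y z w : Fin N} → x ≢ y → ｛ x , y ｝ ≡ ｛ z , w ｝ → (x ≡ z × y ≡ w) ⊎ (x ≡ w × y ≡ z)
pair-injective {x = x} {y} {z} {w} x≢y eq
  with ∈-pair⁻ (subst (x ∈ᵥ_) eq (∈-pairˡ x y)) | ∈-pair⁻ (subst (y ∈ᵥ_) eq (∈-pairʳ x y))
... | inj₁ p | inj₂ q = inj₁ (p , q)
... | inj₂ p | inj₁ q = inj₂ (p , q)
... | inj₁ p | inj₁ q = contradiction (trans p (sym q)) x≢y
... | inj₂ p | inj₂ q = contradiction (trans p (sym q)) x≢y

-- Perfect matchings of P(n,2) and their words

module Matchings (n : ℕ) (n≥3 : 3 ≤ n) (n≢4 : n ≢ 4) where

  private instance
    n≢0 : NonZero n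
    n≢0 = 3≤⇒nonZero n≥3

  open Petersen n

  E : Set
  E = Edge (n + n)

  edge : Kind → ℕ → E
  edge uuᴷ    = uu
  edge spokeᴷ = spoke
  edge vvᴷ    = vv

  IsPM : EdgeSet (n + n) → Set
  IsPM = IsPerfectMatching (P n n≥3)

  u-cong : ∀ {i j} → i % n ≡ j % n → u i ≡ u j
  u-cong {i} {j} eq = cong (_↑ˡ n) (%⇒mod n {i} {j} eq)

  v-cong : ∀ {i j} → i % n ≡ j % n → v i ≡ v j
  v-cong {i} {j} eq = cong (n ↑ʳ_) (%⇒mod n {i} {j} eq)

  u-injective : ∀ {i j} → u i ≡ u j → i % n ≡ j % n
  u-injective {i} {j} eq = mod⇒% n {i} {j} (Fin.↑ˡ-injective n _ _ eq)

  v-injective : ∀ {i j} → v i ≡ v j → i % n ≡ j % n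
  v-injective {i} {j} eq = mod⇒% n {i} {j} (Fin.↑ʳ-injective n _ _ eq)

  %-shiftʳ : ∀ d {i j} → i % n ≡ j % n → (i + d) % n ≡ (j + d) % n
  %-shiftʳ d {i} {j} eq = subst₂ (λ a b → a % n ≡ b % n) (+-comm d i) (+-comm d j) (%-shift n d {i} {j} eq)

  %-cancelʳ : ∀ d {i j} → (i + d) % n ≡ (j + d) % n → i % n ≡ j % n
  %-cancelʳ d {i} {j} eq = %-cancelˡ n d {i} {j} (subst₂ (λ a b → a % n ≡ b % n) (+-comm i d) (+-comm j d) eq)

  edge-cong : ∀ k {i j} → i % n ≡ j % n → edge k i ≡ edge k j
  edge-cong uuᴷ    {i} {j} eq = cong₂ ｛_,_｝ (u-cong {i} {j} eq) (u-cong {i + 2} {j + 2} (%-shiftʳ 2 {i} {j} eq))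
  edge-cong spokeᴷ {i} {j} eq = cong₂ ｛_,_｝ (u-cong {i} {j} eq) (v-cong {i} {j} eq)
  edge-cong vvᴷ    {i} {j} eq = cong₂ ｛_,_｝ (v-cong {i} {j} eq) (v-cong {i + 1} {j + 1} (%-shiftʳ 1 {i} {j} eq))

  no-shift : ∀ d .{{_ : NonZero d}} → d < n → ∀ j → (j + d) % n ≢ j % n
  no-shift d d<n j eq = mod-shift n j d d<n (%⇒mod n {j} {j + d} (sym eq))

  no-shift-2 : ∀ j → (j + 2) % n ≢ j % n
  no-shift-2 = no-shift 2 n≥3

  no-shift-1 : ∀ j → (j + 1) % n ≢ j % n
  no-shift-1 = no-shift 1 (≤-trans (n≤1+n 2) n≥3)

  -- This is where n ≠ 4 enters: for n = 4 the edges `uu j` and `uu (j + 2)` coincide.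
  no-shift-4 : ∀ j → (j + 2 + 2) % n ≢ j % n
  no-shift-4 j eq with <-cmp 4 n
  ... | tri< 4<n _ _ = no-shift 4 4<n j (subst (λ z → z % n ≡ j % n) (+-assoc j 2 2) eq)
  ... | tri≈ _ 4≡n _ = n≢4 (sym 4≡n)
  -- Here n = 3, and a shift by 4 is a shift by 1.
  ... | tri> _ _ n<4 = no-shift-1 j (trans (sym ([m+n]%n≡m%n (j + 1) n)) (trans (cong (_% n) lemma) eq))
    where
    lemma : j + 1 + n ≡ j + 2 + 2
    lemma = trans (cong (j + 1 +_) (≤-antisym (s≤s⁻¹ n<4) n≥3)) (trans (+-assoc j 1 3) (sym (+-assoc j 2 2)))

  v∉uu : ∀ {i j} → ¬ v j ∈ᵥ uu i
  v∉uu {i} {j} p with ∈-pair⁻ p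
  ... | inj₁ eq = u≢v i j (sym eq)
  ... | inj₂ eq = u≢v (i + 2) j (sym eq)

  u∉vv : ∀ {i j} → ¬ u j ∈ᵥ vv i
  u∉vv {i} {j} p with ∈-pair⁻ p
  ... | inj₁ eq = u≢v j i eq
  ... | inj₂ eq = u≢v j (i + 1) eq

  -- Identifying two edges of the same kind with their ends reversed would make a shift by 4 (for
  -- `uu`) or by 2 (for `vv`) trivial modulo n, or a u equal to a v (for `spoke`). Edges of
  -- different kinds differ in whether they contain a u or a v.
  edge-injective : ∀ k k′ {i j} → edge k i ≡ edge k′ j → k ≡ k′ × i % n ≡ j % n
  edge-injective uuᴷ uuᴷ {i} {j} eq with pair-injective (λ p → no-shift-2 i (sym (u-injective {i} {i + 2} p))) eq
  ... | inj₁ (p , _) = refl , u-injective {i} {j} p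
  ... | inj₂ (p , q) = contradiction
    (trans (sym (%-shiftʳ 2 {i} {j + 2} (u-injective {i} {j + 2} p))) (u-injective {i + 2} {j} q)) (no-shift-4 j)
  edge-injective vvᴷ vvᴷ {i} {j} eq with pair-injective (λ p → no-shift-1 i (sym (v-injective {i} {i + 1} p))) eq
  ... | inj₁ (p , _) = refl , v-injective {i} {j} p
  ... | inj₂ (p , q) = contradiction
    (trans (cong (_% n) (sym (+-assoc j 1 1)))
      (trans (sym (%-shiftʳ 1 {i} {j + 1} (v-injective {i} {j + 1} p))) (v-injective {i + 1} {j} q))) (no-shift-2 j)
  edge-injective spokeᴷ spokeᴷ {i} {j} eq with pair-injective (u≢v i i) eq
  ... | inj₁ (p , _) = refl , u-injective {i} {j} p
  ... | inj₂ (p , _) = contradiction p (u≢v i j)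
  edge-injective uuᴷ spokeᴷ {i} {j} eq = contradiction (subst (v j ∈ᵥ_) (sym eq) (∈-pairʳ (u j) (v j))) (v∉uu {i} {j})
  edge-injective spokeᴷ uuᴷ {i} {j} eq = contradiction (subst (v i ∈ᵥ_) eq (∈-pairʳ (u i) (v i))) (v∉uu {j} {i})
  edge-injective uuᴷ vvᴷ {i} {j} eq = contradiction (subst (v j ∈ᵥ_) (sym eq) (∈-pairˡ (v j) (v (j + 1)))) (v∉uu {i} {j})
  edge-injective vvᴷ uuᴷ {i} {j} eq = contradiction (subst (v i ∈ᵥ_) eq (∈-pairˡ (v i) (v (i + 1)))) (v∉uu {j} {i})
  edge-injective spokeᴷ vvᴷ {i} {j} eq = contradiction (subst (u i ∈ᵥ_) eq (∈-pairˡ (u i) (v i))) (u∉vv {j} {i})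
  edge-injective vvᴷ spokeᴷ {i} {j} eq = contradiction (subst (u j ∈ᵥ_) (sym eq) (∈-pairˡ (u j) (v j))) (u∉vv {i} {j})

  isEdge : ∀ k i → IsEdgeP (edge k i)
  isEdge k i = i % n , m%n<n i n , of k
    where
    of : ∀ k → edge k i ≡ uu (i % n) ⊎ edge k i ≡ spoke (i % n) ⊎ edge k i ≡ vv (i % n)
    of uuᴷ    = inj₁ (edge-cong uuᴷ {i} {i % n} (sym (m%n%n≡m%n i n)))
    of spokeᴷ = inj₂ (inj₁ (edge-cong spokeᴷ {i} {i % n} (sym (m%n%n≡m%n i n))))
    of vvᴷ    = inj₂ (inj₂ (edge-cong vvᴷ {i} {i % n} (sym (m%n%n≡m%n i n))))

  isEdge⁻ : ∀ {e} → IsEdgeP e → ∃₂ λ k i → e ≡ edge k i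
  isEdge⁻ (i , _ , inj₁ eq)        = uuᴷ , i , eq
  isEdge⁻ (i , _ , inj₂ (inj₁ eq)) = spokeᴷ , i , eq
  isEdge⁻ (i , _ , inj₂ (inj₂ eq)) = vvᴷ , i , eq

  -- Edge sets and words of length n

  open DecMembership {A = E} (Vec.≡-dec Bool._≟_) using () renaming (_∈?_ to _∈ᴱ?_)

  lab : EdgeSet (n + n) → ℕ → Letter
  lab M i = does (uu i ∈ᴱ? M) , does (spoke i ∈ᴱ? M) , does (vv i ∈ᴱ? M)

  ∈-lab⁺ : ∀ {M} k {i} → edge k i ∈ M → has (lab M i) k ≡ true
  ∈-lab⁺ uuᴷ    = dec-true (_ ∈ᴱ? _)
  ∈-lab⁺ spokeᴷ = dec-true (_ ∈ᴱ? _)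
  ∈-lab⁺ vvᴷ    = dec-true (_ ∈ᴱ? _)

  does⇒ : ∀ {A : Set} (d : Dec A) → does d ≡ true → A
  does⇒ (yes a) _ = a

  ∈-lab⁻ : ∀ {M} k {i} → has (lab M i) k ≡ true → edge k i ∈ M
  ∈-lab⁻ uuᴷ    = does⇒ (_ ∈ᴱ? _)
  ∈-lab⁻ spokeᴷ = does⇒ (_ ∈ᴱ? _)
  ∈-lab⁻ vvᴷ    = does⇒ (_ ∈ᴱ? _)

  lab-⊆ : ∀ {M N} → M ⊆ N → ∀ i → lab M i ≼ lab N i
  lab-⊆ sub i = ≼-intro λ k eq → ∈-lab⁺ k (sub (∈-lab⁻ k eq))

  lab-resp : ∀ {M N} → M ∼[ set ] N → ∀ i → lab M i ≡ lab N i
  lab-resp M∼N i = letter-ext (λ k eq → ∈-lab⁺ k (Equivalence.to M∼N (∈-lab⁻ k eq)))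
                              (λ k eq → ∈-lab⁺ k (Equivalence.from M∼N (∈-lab⁻ k eq)))

  lab-cong : ∀ M {i j} → i % n ≡ j % n → lab M i ≡ lab M j
  lab-cong M {i} {j} eq = letter-ext (λ k p → ∈-lab⁺ k (subst (_∈ M) (edge-cong k {i} {j} eq) (∈-lab⁻ k p)))
                                     (λ k p → ∈-lab⁺ k (subst (_∈ M) (sym (edge-cong k {i} {j} eq)) (∈-lab⁻ k p)))

  labels : EdgeSet (n + n) → ℕ → ℕ → Word
  labels M o zero    = []
  labels M o (suc m) = lab M o ∷ labels M (suc o) m

  length-labels : ∀ M o m → length (labels M o m) ≡ m
  length-labels M o zero    = refl
  length-labels M o (suc m) = cong suc (length-labels M (suc o) m)

  nth-labels : ∀ M o {m} i → i < m → nth (labels M o m) i ≡ lab M (o + i)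
  nth-labels M o {suc m} zero    lt       = cong (lab M) (sym (+-identityʳ o))
  nth-labels M o {suc m} (suc i) (s≤s lt) = trans (nth-labels M (suc o) i lt) (cong (lab M) (sym (+-suc o i)))

  labels-⊆ : ∀ {M N} → M ⊆ N → ∀ o m → labels M o m ⊑ labels N o m
  labels-⊆ sub o zero    = []
  labels-⊆ sub o (suc m) = lab-⊆ sub o ∷ labels-⊆ sub (suc o) m

  labels-resp : ∀ {M N} → M ∼[ set ] N → ∀ o m → labels M o m ≡ labels N o m
  labels-resp M∼N o zero    = refl
  labels-resp M∼N o (suc m) = cong₂ _∷_ (lab-resp M∼N o) (labels-resp M∼N (suc o) m)

  letterEdges : ℕ → Letter → EdgeSet (n + n)
  letterEdges i a = map (λ k → edge k i) (filter (λ k → has a k Bool.≟ true) kinds)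

  edgesOf : ℕ → Word → EdgeSet (n + n)
  edgesOf o []      = []
  edgesOf o (a ∷ w) = letterEdges o a ++ edgesOf (suc o) w

  ∈-edgesOf⁺ : ∀ o w i k → has (nth w i) k ≡ true → edge k (o + i) ∈ edgesOf o w
  ∈-edgesOf⁺ o []      i       k eq = contradiction eq (nth-∅ i k)
  ∈-edgesOf⁺ o (a ∷ w) zero    k eq = ∈-++⁺ˡ (subst (λ o′ → edge k o′ ∈ letterEdges o a) (sym (+-identityʳ o))
    (∈-map⁺ (λ k → edge k o) (∈-filter⁺ (λ k → has a k Bool.≟ true) (∈-kinds k) eq)))
    where
    ∈-kinds : ∀ k → k ∈ kinds
    ∈-kinds uuᴷ    = here refl
    ∈-kinds spokeᴷ = there (here refl)
    ∈-kinds vvᴷ    = there (there (here refl))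
  ∈-edgesOf⁺ o (a ∷ w) (suc i) k eq = ∈-++⁺ʳ (letterEdges o a)
    (subst (λ o′ → edge k o′ ∈ edgesOf (suc o) w) (sym (+-suc o i)) (∈-edgesOf⁺ (suc o) w i k eq))

  ∈-edgesOf⁻ : ∀ o w {e} → e ∈ edgesOf o w →
               ∃₂ λ i k → i < length w × has (nth w i) k ≡ true × e ≡ edge k (o + i)
  ∈-edgesOf⁻ o (a ∷ w) {e} e∈ with ∈-++⁻ (letterEdges o a) e∈
  ... | inj₂ p = let i , k , lt , h , eq = ∈-edgesOf⁻ (suc o) w p in
    suc i , k , s≤s lt , h , trans eq (cong (edge k) (sym (+-suc o i)))
  ... | inj₁ p with ∈-map⁻ (λ k → edge k o) p
  ... | k , k∈ , eq = 0 , k , s≤s z≤n , proj₂ (∈-filter⁻ (λ k → has a k Bool.≟ true) {xs = kinds} k∈) ,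
    trans eq (cong (edge k) (sym (+-identityʳ o)))

  length-edgesOf : ∀ o w → length (edgesOf o w) ≡ weight w
  length-edgesOf o []      = refl
  length-edgesOf o (a ∷ w) = trans (List.length-++ (letterEdges o a))
    (cong₂ _+_ (length-letterEdges a) (length-edgesOf (suc o) w))
    where
    length-letterEdges : ∀ a → length (letterEdges o a) ≡ size a
    length-letterEdges (true  , true  , true)  = refl
    length-letterEdges (true  , true  , false) = refl
    length-letterEdges (true  , false , true)  = refl
    length-letterEdges (true  , false , false) = refl
    length-letterEdges (false , true  , true)  = refl
    length-letterEdges (false , true  , false) = refl
    length-letterEdges (false , false , true)  = refl
    length-letterEdges (false , false , false) = refl

  edgesOf-unique : ∀ o w → length w ≤ n → Unique (edgesOf o w)
  edgesOf-unique o []      le = []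
  edgesOf-unique o (a ∷ w) le = Unique.++⁺
    (Unique.map⁺ (λ {k} {k′} eq → proj₁ (edge-injective k k′ {o} {o} eq))
      (Unique.filter⁺ (λ k → has a k Bool.≟ true) kinds-unique))
    (edgesOf-unique (suc o) w (≤-trans (n≤1+n _) le))
    disjoint
    where
    kinds-unique : Unique kinds
    kinds-unique = ((λ ()) ∷ (λ ()) ∷ []) ∷ ((λ ()) ∷ []) ∷ [] ∷ []
    disjoint : ∀ {e} → ¬ (e ∈ letterEdges o a × e ∈ edgesOf (suc o) w)
    disjoint (p , q) with ∈-map⁻ (λ k → edge k o) p | ∈-edgesOf⁻ (suc o) w q
    ... | k , _ , refl | i , k′ , lt , _ , eq =
      no-shift (suc i) (≤-trans (s≤s lt) le) o
        (sym (trans (proj₂ (edge-injective k k′ {o} {suc o + i} eq)) (cong (_% n) (sym (+-suc o i)))))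

  edgesOf-mono : ∀ o {σ w} → σ ⊑ w → edgesOf o σ ⊆ edgesOf o w
  edgesOf-mono o {σ} {w} le e∈ with ∈-edgesOf⁻ o σ e∈
  ... | i , k , _ , h , refl = ∈-edgesOf⁺ o w i k (≼-elim (nth-mono le i) k h)

  lab-edgesOf : ∀ o w → length w ≡ n → ∀ i → i < n → lab (edgesOf o w) (o + i) ≡ nth w i
  lab-edgesOf o w len i i<n = letter-ext to (λ k h → ∈-lab⁺ k (∈-edgesOf⁺ o w i k h))
    where
    to : ∀ k → has (lab (edgesOf o w) (o + i)) k ≡ true → has (nth w i) k ≡ true
    to k h with ∈-edgesOf⁻ o w (∈-lab⁻ k h)
    ... | j , k′ , j<len , h′ , eq with edge-injective k k′ {o + i} {o + j} eq
    ... | refl , eq′ = subst (λ i → has (nth w i) k ≡ true) j≡i h′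
      where
      j≡i : j ≡ i
      j≡i = trans (sym (m<n⇒m%n≡m (subst (j <_) len j<len)))
              (trans (sym (%-cancelˡ n o {i} {j} eq′)) (m<n⇒m%n≡m i<n))

  labels-edgesOf : ∀ o w → length w ≡ n → labels (edgesOf o w) o n ≡ w
  labels-edgesOf o w len = nth-ext (trans (length-labels _ o n) (sym len)) λ i lt →
    let i<n = subst (i <_) (length-labels _ o n) lt in
    trans (nth-labels (edgesOf o w) o i i<n) (lab-edgesOf o w len i i<n)

  edgesOf-labels : ∀ {M} o → All IsEdgeP M → edgesOf o (labels M o n) ∼[ set ] M
  edgesOf-labels {M} o edges = mk⇔ to from
    where
    to : ∀ {e} → e ∈ edgesOf o (labels M o n) → e ∈ M
    to e∈ with ∈-edgesOf⁻ o (labels M o n) e∈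
    ... | i , k , lt , h , refl =
      ∈-lab⁻ k (subst (λ a → has a k ≡ true) (nth-labels M o i (subst (i <_) (length-labels M o n) lt)) h)
    from : ∀ {e} → e ∈ M → e ∈ edgesOf o (labels M o n)
    from e∈ with isEdge⁻ (All.lookup edges e∈)
    ... | k , j , refl with %-reach n o j
    ... | i , i<n , eq = subst (_∈ edgesOf o (labels M o n)) (edge-cong k {o + i} {j} eq)
      (∈-edgesOf⁺ o (labels M o n) i k (subst (λ a → has a k ≡ true) (sym (nth-labels M o i i<n))
        (∈-lab⁺ k (subst (_∈ M) (sym (edge-cong k {o + i} {j} eq)) e∈))))

  edgesOf-edges : ∀ o w → All IsEdgeP (edgesOf o w)
  edgesOf-edges o w = All.tabulate λ e∈ → let i , k , _ , _ , eq = ∈-edgesOf⁻ o w e∈ in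
    subst IsEdgeP (sym eq) (isEdge k (o + i))

  -- The three edges at a vertex

  record Incidence (x : Fin (n + n)) (k₁ k₂ k₃ : Kind) (i₁ i₂ i₃ : ℕ) : Set where
    field
      classify : ∀ {e} → IsEdgeP e → x ∈ᵥ e → e ≡ edge k₁ i₁ ⊎ e ≡ edge k₂ i₂ ⊎ e ≡ edge k₃ i₃
      in₁      : x ∈ᵥ edge k₁ i₁
      in₂      : x ∈ᵥ edge k₂ i₂
      in₃      : x ∈ᵥ edge k₃ i₃
      e₁≢e₂    : edge k₁ i₁ ≢ edge k₂ i₂
      e₁≢e₃    : edge k₁ i₁ ≢ edge k₃ i₃
      e₂≢e₃    : edge k₂ i₂ ≢ edge k₃ i₃

  -- The vertex is indexed by 2 + i so that its backward neighbour has index i and no subtraction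
  -- modulo n occurs.
  u-incidence : ∀ i → Incidence (u (2 + i)) uuᴷ spokeᴷ uuᴷ i (2 + i) (2 + i)
  u-incidence i = record
    { classify = λ isE x∈ → let k , j , eq = isEdge⁻ isE in
        Sum.map (trans eq) (Sum.map (trans eq) (trans eq)) (classify k j (subst (u (2 + i) ∈ᵥ_) eq x∈))
    ; in₁   = subst (λ j → u j ∈ᵥ uu i) (+-comm i 2) (∈-pairʳ (u i) (u (i + 2)))
    ; in₂   = ∈-pairˡ (u (2 + i)) (v (2 + i))
    ; in₃   = ∈-pairˡ (u (2 + i)) (u (2 + i + 2))
    ; e₁≢e₂ = λ eq → contradiction (proj₁ (edge-injective uuᴷ spokeᴷ {i} {2 + i} eq)) λ ()
    ; e₁≢e₃ = λ eq → no-shift-2 i (trans (cong (_% n) (+-comm i 2)) (sym (proj₂ (edge-injective uuᴷ uuᴷ {i} {2 + i} eq))))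
    ; e₂≢e₃ = λ eq → contradiction (proj₁ (edge-injective spokeᴷ uuᴷ {2 + i} {2 + i} eq)) λ ()
    }
    where
    classify : ∀ k j → u (2 + i) ∈ᵥ edge k j → edge k j ≡ uu i ⊎ edge k j ≡ spoke (2 + i) ⊎ edge k j ≡ uu (2 + i)
    classify uuᴷ j x∈ with ∈-pair⁻ x∈
    ... | inj₁ eq = inj₂ (inj₂ (edge-cong uuᴷ {j} {2 + i} (sym (u-injective {2 + i} {j} eq))))
    ... | inj₂ eq = inj₁ (edge-cong uuᴷ {j} {i} (sym (%-cancelʳ 2 {i} {j}
                      (trans (cong (_% n) (+-comm i 2)) (u-injective {2 + i} {j + 2} eq)))))
    classify spokeᴷ j x∈ with ∈-pair⁻ x∈
    ... | inj₁ eq = inj₂ (inj₁ (edge-cong spokeᴷ {j} {2 + i} (sym (u-injective {2 + i} {j} eq))))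
    ... | inj₂ eq = contradiction eq (u≢v (2 + i) j)
    classify vvᴷ j x∈ = contradiction x∈ (u∉vv {j} {2 + i})

  v-incidence : ∀ i → Incidence (v (1 + i)) vvᴷ spokeᴷ vvᴷ i (1 + i) (1 + i)
  v-incidence i = record
    { classify = λ isE x∈ → let k , j , eq = isEdge⁻ isE in
        Sum.map (trans eq) (Sum.map (trans eq) (trans eq)) (classify k j (subst (v (1 + i) ∈ᵥ_) eq x∈))
    ; in₁   = subst (λ j → v j ∈ᵥ vv i) (+-comm i 1) (∈-pairʳ (v i) (v (i + 1)))
    ; in₂   = ∈-pairʳ (u (1 + i)) (v (1 + i))
    ; in₃   = ∈-pairˡ (v (1 + i)) (v (1 + i + 1))
    ; e₁≢e₂ = λ eq → contradiction (proj₁ (edge-injective vvᴷ spokeᴷ {i} {1 + i} eq)) λ ()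
    ; e₁≢e₃ = λ eq → no-shift-1 i (trans (cong (_% n) (+-comm i 1)) (sym (proj₂ (edge-injective vvᴷ vvᴷ {i} {1 + i} eq))))
    ; e₂≢e₃ = λ eq → contradiction (proj₁ (edge-injective spokeᴷ vvᴷ {1 + i} {1 + i} eq)) λ ()
    }
    where
    classify : ∀ k j → v (1 + i) ∈ᵥ edge k j → edge k j ≡ vv i ⊎ edge k j ≡ spoke (1 + i) ⊎ edge k j ≡ vv (1 + i)
    classify vvᴷ j x∈ with ∈-pair⁻ x∈
    ... | inj₁ eq = inj₂ (inj₂ (edge-cong vvᴷ {j} {1 + i} (sym (v-injective {1 + i} {j} eq))))
    ... | inj₂ eq = inj₁ (edge-cong vvᴷ {j} {i} (sym (%-cancelʳ 1 {i} {j}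
                      (trans (cong (_% n) (+-comm i 1)) (v-injective {1 + i} {j + 1} eq)))))
    classify spokeᴷ j x∈ with ∈-pair⁻ x∈
    ... | inj₁ eq = contradiction (sym eq) (u≢v j (1 + i))
    ... | inj₂ eq = inj₂ (inj₁ (edge-cong spokeᴷ {j} {1 + i} (sym (v-injective {1 + i} {j} eq))))
    classify uuᴷ j x∈ = contradiction x∈ (v∉uu {j} {1 + i})

  module _ {x k₁ k₂ k₃ i₁ i₂ i₃} (inc : Incidence x k₁ k₂ k₃ i₁ i₂ i₃) {M : EdgeSet (n + n)} (edges : All IsEdgeP M) where
    open Incidence inc

    private
      One : Set
      One = one (has (lab M i₁) k₁) (has (lab M i₂) k₂) (has (lab M i₃) k₃) ≡ true

    covered⇒one : ∃! _≡_ (λ e → e ∈ M × x ∈ᵥ e) → One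
    covered⇒one (e , (e∈ , x∈) , uniq) = one-intro
      (Sum.map (λ eq → ∈-lab⁺ k₁ (subst (_∈ M) eq e∈))
        (Sum.map (λ eq → ∈-lab⁺ k₂ (subst (_∈ M) eq e∈)) (λ eq → ∈-lab⁺ k₃ (subst (_∈ M) eq e∈)))
        (classify (All.lookup edges e∈) x∈))
      (λ (p , q) → e₁≢e₂ (trans (sym (uniq (∈-lab⁻ k₁ p , in₁))) (uniq (∈-lab⁻ k₂ q , in₂))))
      (λ (p , q) → e₁≢e₃ (trans (sym (uniq (∈-lab⁻ k₁ p , in₁))) (uniq (∈-lab⁻ k₃ q , in₃))))
      (λ (p , q) → e₂≢e₃ (trans (sym (uniq (∈-lab⁻ k₂ p , in₂))) (uniq (∈-lab⁻ k₃ q , in₃))))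

    one⇒covered : One → ∃! _≡_ (λ e → e ∈ M × x ∈ᵥ e)
    one⇒covered o with has (lab M i₁) k₁ in p₁ | has (lab M i₂) k₂ in p₂ | has (lab M i₃) k₃ in p₃
    one⇒covered () | true | true | _
    one⇒covered () | true | false | true
    one⇒covered () | false | true | true
    one⇒covered () | false | false | false
    one⇒covered _ | true | false | false = edge k₁ i₁ , (∈-lab⁻ k₁ p₁ , in₁) , λ (y∈ , x∈) →
      case y∈ (classify (All.lookup edges y∈) x∈)
      where
      case : ∀ {y} → y ∈ M → y ≡ edge k₁ i₁ ⊎ y ≡ edge k₂ i₂ ⊎ y ≡ edge k₃ i₃ → edge k₁ i₁ ≡ y
      case y∈ (inj₁ eq) = sym eq
      case y∈ (inj₂ (inj₁ refl)) = contradiction (trans (sym p₂) (∈-lab⁺ k₂ y∈)) λ ()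
      case y∈ (inj₂ (inj₂ refl)) = contradiction (trans (sym p₃) (∈-lab⁺ k₃ y∈)) λ ()
    one⇒covered _ | false | true | false = edge k₂ i₂ , (∈-lab⁻ k₂ p₂ , in₂) , λ (y∈ , x∈) →
      case y∈ (classify (All.lookup edges y∈) x∈)
      where
      case : ∀ {y} → y ∈ M → y ≡ edge k₁ i₁ ⊎ y ≡ edge k₂ i₂ ⊎ y ≡ edge k₃ i₃ → edge k₂ i₂ ≡ y
      case y∈ (inj₁ refl) = contradiction (trans (sym p₁) (∈-lab⁺ k₁ y∈)) λ ()
      case y∈ (inj₂ (inj₁ eq)) = sym eq
      case y∈ (inj₂ (inj₂ refl)) = contradiction (trans (sym p₃) (∈-lab⁺ k₃ y∈)) λ ()
    one⇒covered _ | false | false | true = edge k₃ i₃ , (∈-lab⁻ k₃ p₃ , in₃) , λ (y∈ , x∈) →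
      case y∈ (classify (All.lookup edges y∈) x∈)
      where
      case : ∀ {y} → y ∈ M → y ≡ edge k₁ i₁ ⊎ y ≡ edge k₂ i₂ ⊎ y ≡ edge k₃ i₃ → edge k₃ i₃ ≡ y
      case y∈ (inj₁ refl) = contradiction (trans (sym p₁) (∈-lab⁺ k₁ y∈)) λ ()
      case y∈ (inj₂ (inj₁ refl)) = contradiction (trans (sym p₂) (∈-lab⁺ k₂ y∈)) λ ()
      case y∈ (inj₂ (inj₂ eq)) = sym eq

  -- Perfect matchings as closed runs

  LocalAt : EdgeSet (n + n) → ℕ → Set
  LocalAt M i = Compatible (lab M i) (lab M (1 + i)) (lab M (2 + i))

  PM⇒local : ∀ {M} → IsPM M → ∀ i → LocalAt M i
  PM⇒local pm i = covered⇒one (u-incidence i) edges (covers (u (2 + i))) ,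
                  covered⇒one (v-incidence i) edges (covers (v (1 + i)))
    where open IsPerfectMatching pm

  local⇒PM : ∀ {M} o → Unique M → All IsEdgeP M → (∀ i → LocalAt M (o + i)) → IsPM M
  local⇒PM {M} o uniq edges local = record { unique = uniq ; edges = edges ; covers = covers }
    where
    reach : ∀ d (j : Fin n) → ∃[ i ] (d + i) mod n ≡ j
    reach d j = let i , _ , eq = %-reach n d (toℕ j) in
      i , Fin.toℕ-injective (trans (toℕ-mod n (d + i)) (trans eq (m<n⇒m%n≡m (Fin.toℕ<n j))))
    covers : ∀ x → ∃! _≡_ (λ e → e ∈ M × x ∈ᵥ e)
    covers x with splitAt n x in eq
    ... | inj₁ j = let i , p = reach (2 + o) j in
      subst (λ x → ∃! _≡_ (λ e → e ∈ M × x ∈ᵥ e)) (trans (cong (_↑ˡ n) p) (Fin.splitAt⁻¹-↑ˡ eq))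
        (one⇒covered (u-incidence (o + i)) edges (proj₁ (local i)))
    ... | inj₂ j = let i , p = reach (1 + o) j in
      subst (λ x → ∃! _≡_ (λ e → e ∈ M × x ∈ᵥ e)) (trans (cong (n ↑ʳ_) p) (Fin.splitAt⁻¹-↑ʳ eq))
        (one⇒covered (v-incidence (o + i)) edges (proj₂ (local i)))

  -- Conditions that straddle the end of `w` are read off `w ++ w`, which is again a run because `w`
  -- is closed.
  closed⇒PM : ∀ o w → length w ≡ n → Closed w → IsPM (edgesOf o w)
  closed⇒PM o w len (s , ρ) = local⇒PM o (edgesOf-unique o w (≤-reflexive len)) (edgesOf-edges o w) local
    where
    M = edgesOf o w
    nth-cyclic : ∀ j → j < n + n → nth (w ++ w) j ≡ nth w (j % n)
    nth-cyclic j lt with j <? n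
    ... | yes j<n = trans (nth-++ˡ w (subst (j <_) (sym len) j<n)) (cong (nth w) (sym (m<n⇒m%n≡m j<n)))
    ... | no  j≮n = trans (cong (nth (w ++ w)) (sym (trans (cong (_+ (j ∸ n)) len) (m+[n∸m]≡n n≤j))))
                      (trans (nth-++ʳ w (j ∸ n)) (cong (nth w) (sym
                        (trans (sym (m≤n⇒[n∸m]%m≡n%m n≤j)) (m<n⇒m%n≡m (m<n+o⇒m∸n<o j n lt))))))
      where n≤j = ≮⇒≥ j≮n
    lab-nth : ∀ d i → d ≤ 2 → lab M (d + (o + i)) ≡ nth (w ++ w) (d + i % n)
    lab-nth d i d≤2 = begin
      lab M (d + (o + i))           ≡⟨ cong (lab M) (trans (sym (+-assoc d o i)) (trans (cong (_+ i) (+-comm d o)) (+-assoc o d i))) ⟩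
      lab M (o + (d + i))           ≡⟨ lab-cong M {o + (d + i)} {o + (d + i) % n}
                                         (%-shift n o {d + i} {(d + i) % n} (sym (m%n%n≡m%n (d + i) n))) ⟩
      lab M (o + (d + i) % n)       ≡⟨ lab-edgesOf o w len ((d + i) % n) (m%n<n (d + i) n) ⟩
      nth w ((d + i) % n)           ≡⟨ cong (nth w) (%-shift n d {i} {i % n} (sym (m%n%n≡m%n i n))) ⟩
      nth w ((d + i % n) % n)       ≡⟨ nth-cyclic (d + i % n) (+-mono-≤-< (≤-trans d≤2 (≤-trans (n≤1+n 2) n≥3)) (m%n<n i n)) ⟨
      nth (w ++ w) (d + i % n)      ∎
      where open ≡-Reasoning
    local : ∀ i → LocalAt M (o + i)
    local i = transport (lab-nth 0 i z≤n) (lab-nth 1 i (s≤s z≤n)) (lab-nth 2 i ≤-refl)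
      (Run-local (ρ ++ᴿ ρ) (i % n) (subst (2 + i % n <_) (sym (trans (List.length-++ w) (cong₂ _+_ len len)))
        (+-mono-<-≤ n≥3 (<⇒≤ (m%n<n i n)))))
      where
      transport : ∀ {a b c a′ b′ c′} → a ≡ a′ → b ≡ b′ → c ≡ c′ → Compatible a′ b′ c′ → Compatible a b c
      transport refl refl refl p = p

  -- The state of the cut before index i + 2, not i: hence the offsets by 2 in what follows.
  cut : EdgeSet (n + n) → ℕ → State
  cut M i = has (lab M (1 + i)) vvᴷ , has (lab M i) uuᴷ , has (lab M (1 + i)) uuᴷ

  cut-cong : ∀ M {i j} → i % n ≡ j % n → cut M i ≡ cut M j
  cut-cong M {i} {j} eq = cong₂ (λ a b → has b vvᴷ , has a uuᴷ , has b uuᴷ)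
    (lab-cong M {i} {j} eq) (lab-cong M {1 + i} {1 + j} (%-shift n 1 {i} {j} eq))

  fits-cut : ∀ {M} → IsPM M → ∀ i → Fits (cut M i) (lab M (2 + i))
  fits-cut pm i = proj₁ (PM⇒local pm i) , proj₂ (PM⇒local pm (1 + i))

  run-labels : ∀ {M} → IsPM M → ∀ m i → Run (cut M i) (labels M (2 + i) m) (cut M (m + i))
  run-labels pm zero    i = []
  run-labels {M} pm (suc m) i = fits-cut pm i ∷
    subst (λ j → Run (cut M (1 + i)) (labels M (3 + i) m) (cut M j)) (+-suc m i) (run-labels pm m (1 + i))

  run-around : ∀ {M} → IsPM M → ∀ i → Run (cut M i) (labels M (2 + i) n) (cut M i)
  run-around {M} pm i = subst (Run _ _) (cut-cong M {n + i} {i} ([n+m]%n n i)) (run-labels pm n i)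

  -- Forcing sets and masks

  module _ {M : EdgeSet (n + n)} (pm : IsPM M) (o : ℕ) where
    open IsPerfectMatching pm using (edges)

    private
      o′ = 2 + o
      w  = labels M o′ n

    forcing⇒mask : ∀ {S} → IsForcingSet (P n n≥3) M S → Forceable w (length S)
    forcing⇒mask {S} fs = σ , (labels-⊆ subset o′ n , only) , subst (_≤ length S) (length-edgesOf o′ σ)
      (length-⊆ (edgesOf-unique o′ σ (≤-reflexive (length-labels S o′ n))) (Equivalence.to (edgesOf-labels o′ S-edges)))
      where
      open IsForcingSet fs
      σ = labels S o′ n
      S-edges : All IsEdgeP S
      S-edges = All.tabulate λ e∈ → All.lookup edges (subset e∈)
      only : ∀ w′ → Closed w′ → σ ⊑ w′ → w′ ≡ w
      only w′ cl le = trans (sym (labels-edgesOf o′ w′ len))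
        (labels-resp (forcing (edgesOf o′ w′) (closed⇒PM o′ w′ len cl)
          (λ e∈ → edgesOf-mono o′ le (Equivalence.from (edgesOf-labels o′ S-edges) e∈))) o′ n)
        where len = trans (sym (Pointwise.Pointwise-length le)) (length-labels S o′ n)

    mask⇒forcing : ∀ {k} → Forceable w k → ∃[ S ] IsForcingSet (P n n≥3) M S × length S ≤ k
    mask⇒forcing {k} (σ , (σ⊑w , only) , le) = S , record
      { unique  = edgesOf-unique o′ σ (≤-reflexive len)
      ; subset  = λ e∈ → Equivalence.to M-labels (edgesOf-mono o′ σ⊑w e∈)
      ; forcing = forcing
      } , ≤-trans (≤-reflexive (length-edgesOf o′ σ)) le
      where
      S = edgesOf o′ σ
      len : length σ ≡ n
      len = trans (Pointwise.Pointwise-length σ⊑w) (length-labels M o′ n)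
      M-labels : edgesOf o′ w ∼[ set ] M
      M-labels = edgesOf-labels o′ edges
      forcing : ∀ M′ → IsPM M′ → S ⊆ M′ → M′ ∼[ set ] M
      forcing M′ pm′ sub = mk⇔
        (λ e∈ → Equivalence.to M-labels (subst (λ w → _ ∈ edgesOf o′ w) same (Equivalence.from M′-labels e∈)))
        (λ e∈ → Equivalence.to M′-labels (subst (λ w → _ ∈ edgesOf o′ w) (sym same) (Equivalence.from M-labels e∈)))
        where
        M′-labels : edgesOf o′ (labels M′ o′ n) ∼[ set ] M′
        M′-labels = edgesOf-labels o′ (IsPerfectMatching.edges pm′)
        same : labels M′ o′ n ≡ w
        same = only (labels M′ o′ n) (_ , run-around pm′ o)
          (subst (_⊑ labels M′ o′ n) (labels-edgesOf o′ σ len) (labels-⊆ sub o′ n))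

    forcingNumber⇒masks : ∀ {k} → ForcingNumber (P n n≥3) M k →
                          Forceable w k × (∀ {j} → Forceable w j → k ≤ j)
    forcingNumber⇒masks fn =
      (let S , fs , eq = attained in subst (Forceable w) eq (forcing⇒mask fs)) ,
      λ f → let S , fs , le = mask⇒forcing f in ≤-trans (minimal S fs) le
      where open ForcingNumber fn

    masks⇒forcingNumber : ∀ {k} → Forceable w k → (∀ {j} → Forceable w j → k ≤ j) → ForcingNumber (P n n≥3) M k
    masks⇒forcingNumber f min = record
      { attained = let S , fs , le = mask⇒forcing f in S , fs , ≤-antisym le (min (forcing⇒mask fs))
      ; minimal  = λ S fs → min (forcing⇒mask fs)
      }

  -- Gaps between spokes and the parity of the cuts

  module _ {M : EdgeSet (n + n)} (pm : IsPM M) where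

    hasSpoke : ℕ → Bool
    hasSpoke i = has (lab M i) spokeᴷ

    advance : ∀ {s} i → cut M i ≡ s → lab M (2 + i) ∈ options s × cut M (1 + i) ≡ next s (lab M (2 + i))
    advance i refl = ∈-options {cut M i} (fits-cut pm i) , refl

    advance-forced : ∀ {s a} i → options s ≡ [ a ] → cut M i ≡ s →
                     lab M (2 + i) ≡ a × cut M (1 + i) ≡ next s a
    advance-forced {s} i eq c with advance i c
    ... | l∈ , c′ with subst (lab M (2 + i) ∈_) eq l∈
    ... | here l = l , trans c′ (cong (next s) l)

    advance-spokeless : ∀ {q} i → cut M i ≡ (false , false , q) → hasSpoke (2 + i) ≡ false →
                        cut M (1 + i) ≡ (true , q , true)
    advance-spokeless {q} i c ns with advance i c
    ... | here l , _          = contradiction (trans (sym ns) (cong (λ a → has a spokeᴷ) l)) λ ()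
    ... | there (here l) , c′ = trans c′ (cong (next (false , false , q)) l)

    no-spoke : ∀ {a i j} → j ≡ i → hasSpoke j ≡ true → lab M i ≡ a → has a spokeᴷ ≢ false
    no-spoke {a} refl hs l na = contradiction (trans (sym hs) (trans (cong (λ a → has a spokeᴷ) l) na)) λ ()

    gap-shift : ∀ g i {j} → j ≡ 4 + g + (2 + i) → j ≡ g + (2 + (4 + i))
    gap-shift g i eq = trans eq (trans (cong (_+ (2 + i)) (+-comm 4 g)) (+-assoc g 4 (2 + i)))

    -- From an odd cut the letters up to the next spoke read v u (uv ∅ v u)*.
    odd-gap : ∀ g i {j} → j ≡ g + (2 + i) → cut M i ≡ base → hasSpoke j ≡ true →
              (∀ h → 2 + i ≤ h → h < j → hasSpoke h ≡ false) → g % 4 ≡ 2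
    odd-gap g i {j} eq c hs none = go g eq
      where
      s₁ = advance-forced i refl c
      s₂ = advance-forced (1 + i) refl (proj₂ s₁)
      module Longer (g : ℕ) (eq : j ≡ 3 + g + (2 + i)) where
        c₃ : cut M (3 + i) ≡ (true , true , true)
        c₃ = advance-spokeless (2 + i) (proj₂ s₂) (none (4 + i) (m≤n+m (2 + i) 2)
               (≤-trans (m≤n+m (5 + i) g) (≤-reflexive (trans (sym (+-assoc g 3 (2 + i)))
                 (trans (cong (_+ (2 + i)) (+-comm g 3)) (sym eq))))))
        s₄ = advance-forced (3 + i) refl c₃
      go : ∀ g → j ≡ g + (2 + i) → g % 4 ≡ 2
      go 0 eq = contradiction refl (no-spoke eq hs (proj₁ s₁))
      go 1 eq = contradiction refl (no-spoke eq hs (proj₁ s₂))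
      go 2 eq = refl
      go 3 eq = contradiction refl (no-spoke eq hs (proj₁ (Longer.s₄ 0 eq)))
      go (suc (suc (suc (suc g)))) eq = odd-gap g (4 + i) (gap-shift g i eq) (proj₂ (Longer.s₄ (suc g) eq)) hs
        (λ h le → none h (≤-trans (m≤n+m (2 + i) 4) le))

    -- From the empty cut they read (uv u v ∅)*.
    even-gap : ∀ g i {j} → j ≡ g + (2 + i) → cut M i ≡ (false , false , false) → hasSpoke j ≡ true →
               (∀ h → 2 + i ≤ h → h < j → hasSpoke h ≡ false) → g % 4 ≡ 0
    even-gap g i {j} eq c hs none = go g eq
      where
      module Longer (g : ℕ) (eq : j ≡ suc g + (2 + i)) where
        c₁ : cut M (1 + i) ≡ (true , false , true)
        c₁ = advance-spokeless i c (none (2 + i) ≤-refl (≤-trans (m≤n+m (3 + i) g)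
               (≤-reflexive (trans (+-suc g (2 + i)) (sym eq)))))
        s₂ = advance-forced (1 + i) refl c₁
        s₃ = advance-forced (2 + i) refl (proj₂ s₂)
        s₄ = advance-forced (3 + i) refl (proj₂ s₃)
      go : ∀ g → j ≡ g + (2 + i) → g % 4 ≡ 0
      go 0 eq = refl
      go 1 eq = contradiction refl (no-spoke eq hs (proj₁ (Longer.s₂ 0 eq)))
      go 2 eq = contradiction refl (no-spoke eq hs (proj₁ (Longer.s₃ 1 eq)))
      go 3 eq = contradiction refl (no-spoke eq hs (proj₁ (Longer.s₄ 2 eq)))
      go (suc (suc (suc (suc g)))) eq = even-gap g (4 + i) (gap-shift g i eq) (proj₂ (Longer.s₄ (3 + g) eq)) hs
        (λ h le → none h (≤-trans (m≤n+m (2 + i) 4) le))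

    spoke-periodic : ∀ i → hasSpoke (n + i) ≡ hasSpoke i
    spoke-periodic i = cong (λ a → has a spokeᴷ) (lab-cong M {n + i} {i} ([n+m]%n n i))

    cut-after-spoke : ∀ i → hasSpoke (2 + i) ≡ true → cut M (1 + i) ≡ base ⊎ cut M (1 + i) ≡ (false , false , false)
    cut-after-spoke i = after-spoke (cut M i) (lab M (2 + i)) (fits-cut pm i)

    -- A spoke at i is read at n + i, so that the cuts next to it have natural indices: with m = n -
    -- 2 + i they are `cut M m` before it and `cut M (1 + m)` after it.
    2+[n∸2+i] : ∀ i → 2 + (n ∸ 2 + i) ≡ n + i
    2+[n∸2+i] i = cong (_+ i) (m+[n∸m]≡n (≤-trans (n≤1+n 2) n≥3))

    gap-position : ∀ {i j} → i < j → n + j ≡ (j ∸ i ∸ 1) + (2 + (1 + (n ∸ 2 + i)))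
    gap-position {i} {j} i<j = sym (begin
      (j ∸ i ∸ 1) + suc (2 + (n ∸ 2 + i))   ≡⟨ cong (λ z → (j ∸ i ∸ 1) + suc z) (2+[n∸2+i] i) ⟩
      (j ∸ i ∸ 1) + suc (n + i)             ≡⟨ +-comm (j ∸ i ∸ 1) _ ⟩
      suc (n + i) + (j ∸ i ∸ 1)             ≡⟨ cong₂ _+_ (sym (+-suc n i)) (trans (∸-+-assoc j i 1) (cong (j ∸_) (+-comm i 1))) ⟩
      n + suc i + (j ∸ suc i)               ≡⟨ +-assoc n (suc i) _ ⟩
      n + (suc i + (j ∸ suc i))             ≡⟨ cong (n +_) (m+[n∸m]≡n i<j) ⟩
      n + j                                 ∎)
      where open ≡-Reasoning

    -- Oddness excludes the empty cut after a spoke, so each gap starts from `base`.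
    odd⇒spokeCase : (∀ i → Odd (cut M i)) → ∃[ i ] spoke i ∈ M → SpokeCase n n≥3 M
    odd⇒spokeCase odd some = some , gaps
      where
      gaps : ∀ i j → ConsecutiveSpokes n n≥3 M i j → (j ∸ i ∸ 1) % 4 ≡ 2
      gaps i j (i<n , i<j , j≤i+n , i∈ , j∈ , none) =
        odd-gap (j ∸ i ∸ 1) (1 + (n ∸ 2 + i)) (gap-position i<j) start (trans (spoke-periodic j) (∈-lab⁺ spokeᴷ j∈)) clear
        where
        m = n ∸ 2 + i
        start : cut M (1 + m) ≡ base
        start with cut-after-spoke m (trans (cong hasSpoke (2+[n∸2+i] i)) (trans (spoke-periodic i) (∈-lab⁺ spokeᴷ i∈)))
        ... | inj₁ c = c
        ... | inj₂ c = contradiction (subst Odd c (odd (1 + m))) λ ()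
        clear : ∀ h → 3 + m ≤ h → h < n + j → hasSpoke h ≡ false
        clear h le lt with hasSpoke h in eq
        ... | false = refl
        ... | true  = contradiction (∈-lab⁻ spokeᴷ (trans (trans (sym (spoke-periodic (h ∸ n))) (cong hasSpoke n+[h∸n])) eq))
                        (none (h ∸ n) (+-cancelˡ-< n i (h ∸ n) (subst (n + i <_) (sym n+[h∸n]) n+i<h))
                                      (+-cancelˡ-< n (h ∸ n) j (subst (_< n + j) (sym n+[h∸n]) lt)))
          where
          n+i<h : n + i < h
          n+i<h = subst (_< h) (2+[n∸2+i] i) le
          n+[h∸n] : n + (h ∸ n) ≡ h
          n+[h∸n] = m+[n∸m]≡n (≤-trans (m≤m+n n i) (<⇒≤ n+i<h))

    -- A single gap decides the parity: an empty cut after the spoke would make the gap to the next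
    -- spoke divisible by 4.
    spokeCase⇒base : SpokeCase n n≥3 M → ∃[ o ] cut M o ≡ base
    spokeCase⇒base ((i₀ , i₀∈) , gaps) with cut-after-spoke m spoke-m
      where
      i m : ℕ
      i = i₀ % n
      m = n ∸ 2 + i
      spoke-m : hasSpoke (2 + m) ≡ true
      spoke-m = trans (cong hasSpoke (2+[n∸2+i] i)) (trans (spoke-periodic i)
        (trans (cong (λ a → has a spokeᴷ) (lab-cong M {i} {i₀} (m%n%n≡m%n i₀ n))) (∈-lab⁺ spokeᴷ i₀∈)))
    ... | inj₁ c = _ , c
    ... | inj₂ c = contradiction (trans (sym even) odd) λ ()
      where
      i m : ℕ
      i = i₀ % n
      m = n ∸ 2 + i
      spoke-i : hasSpoke i ≡ true
      spoke-i = trans (cong (λ a → has a spokeᴷ) (lab-cong M {i} {i₀} (m%n%n≡m%n i₀ n))) (∈-lab⁺ spokeᴷ i₀∈)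
      nextSpoke : ∃[ g ] g ≤ n ∸ 1 × hasSpoke (suc i + g) ≡ true × (∀ h → h < g → hasSpoke (suc i + h) ≡ false)
      -- The search succeeds at `n ∸ 1` at the latest, where the spoke at i recurs as i + n; this
      -- also covers a matching with a single spoke.
      nextSpoke = least (λ g → hasSpoke (suc i + g)) (n ∸ 1) (trans (cong hasSpoke (begin
        suc i + (n ∸ 1)    ≡⟨ +-suc i (n ∸ 1) ⟨
        i + suc (n ∸ 1)    ≡⟨ cong (i +_) (m+[n∸m]≡n (>-nonZero⁻¹ n)) ⟩
        i + n              ≡⟨ +-comm i n ⟩
        n + i              ∎)) (trans (spoke-periodic i) spoke-i))
        where open ≡-Reasoning
      g = proj₁ nextSpoke
      j = suc i + g
      i<j : i < j
      i<j = m≤m+n (suc i) g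
      j≤i+n : j ≤ i + n
      j≤i+n = ≤-trans (≤-reflexive (sym (+-suc i g))) (+-monoʳ-≤ i (≤-trans (s≤s (proj₁ (proj₂ nextSpoke)))
        (≤-reflexive (m+[n∸m]≡n (>-nonZero⁻¹ n)))))
      j∸i∸1≡g : j ∸ i ∸ 1 ≡ g
      j∸i∸1≡g = trans (∸-+-assoc j i 1) (trans (cong (j ∸_) (+-comm i 1)) (m+n∸m≡n (suc i) g))
      clear : ∀ k → i < k → k < j → hasSpoke k ≡ false
      clear k i<k k<j = trans (cong hasSpoke (sym (m+[n∸m]≡n i<k))) (proj₂ (proj₂ (proj₂ nextSpoke)) (k ∸ suc i)
        (+-cancelˡ-< (suc i) (k ∸ suc i) g (subst (_< j) (sym (m+[n∸m]≡n i<k)) k<j)))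
      odd : (j ∸ i ∸ 1) % 4 ≡ 2
      odd = gaps i j (m%n<n i₀ n , i<j , j≤i+n , ∈-lab⁻ spokeᴷ spoke-i , ∈-lab⁻ spokeᴷ (proj₁ (proj₂ (proj₂ nextSpoke))) ,
        λ k i<k k<j k∈ → contradiction (trans (sym (clear k i<k k<j)) (∈-lab⁺ spokeᴷ k∈)) λ ())
      even : (j ∸ i ∸ 1) % 4 ≡ 0
      even = even-gap (j ∸ i ∸ 1) (1 + m) (gap-position i<j) c
        (trans (spoke-periodic j) (proj₁ (proj₂ (proj₂ nextSpoke)))) λ h le lt →
        let n+i<h   = subst (_< h) (2+[n∸2+i] i) le
            n+[h∸n] = m+[n∸m]≡n (≤-trans (m≤m+n n i) (<⇒≤ n+i<h))
        in trans (cong hasSpoke (sym n+[h∸n])) (trans (spoke-periodic (h ∸ n)) (clear (h ∸ n)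
             (+-cancelˡ-< n i (h ∸ n) (subst (n + i <_) (sym n+[h∸n]) n+i<h))
             (+-cancelˡ-< n (h ∸ n) j (subst (_< n + j) (sym n+[h∸n]) lt))))

    -- The block at k = 0 contains all three edges crossing `cut M j`; from the full state the
    -- letter ∅ is forced and leads to `base`.
    spokelessCase⇒base : SpokelessCase n n≥3 M → ∃[ o ] cut M o ≡ base
    spokelessCase⇒base (_ , divides k n≡k*4 , i , M∼) = 1 + j , proj₂ (advance-forced j refl cut-full)
      where
      j = i + 4 * 0
      block⊆M : block n n≥3 j ⊆ M
      block⊆M e∈ = Equivalence.from M∼ (∈-concatMap (λ k → block n n≥3 (i + 4 * k))
        (∈-upTo⁺ (m≥n⇒m/n>0 4≤n)) e∈)
        where
        4≤n : 4 ≤ n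
        4≤n = ∣⇒≤ (divides k n≡k*4)
      cut-full : cut M j ≡ (true , true , true)
      cut-full = cong₂ _,_
        (∈-lab⁺ vvᴷ (subst (_∈ M) (cong₂ (λ a b → ｛ v a , v b ｝) (+-comm j 1) (trans (+-comm j 2) (cong suc (+-comm 1 j))))
          (block⊆M (there (there (here refl))))))
        (cong₂ _,_ (∈-lab⁺ uuᴷ (block⊆M (here refl)))
          (∈-lab⁺ uuᴷ (subst (_∈ M) (cong₂ (λ a b → ｛ u a , u b ｝) (+-comm j 1) (trans (+-comm j 3) (cong suc (+-comm 2 j))))
            (block⊆M (there (here refl))))))

  -- Members of ℳ₂ as tile words

  ℳ₂⇒tiles : ∀ {M} → ℳ₂ n n≥3 M → IsPM M × ∃₂ λ o ts → labels M (2 + o) n ≡ word ts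
  ℳ₂⇒tiles {M} (pm , inj₂ (n≡4 , _)) = contradiction n≡4 n≢4
  ℳ₂⇒tiles {M} (pm , inj₁ (_ , type)) =
    let o , c    = Sum.[ spokeCase⇒base pm , spokelessCase⇒base pm ]′ type
        ts , eq  = parse (labels M (2 + o) n) (subst (λ s → Run s (labels M (2 + o) n) s) c (run-around pm o))
    in pm , o , ts , eq

  tiles⇒ℳ₂ : ∀ {ts} → three ∈ ts → span ts ≡ n →
             let M = edgesOf 2 (word ts) in ℳ₂ n n≥3 M × labels M 2 n ≡ word ts
  tiles⇒ℳ₂ {ts} 3∈ len = (pm , inj₁ (n≢4 , inj₁ (odd⇒spokeCase pm odd some))) , same
    where
    M = edgesOf 2 (word ts)
    pm : IsPM M
    pm = closed⇒PM 2 (word ts) len (base , Run-word ts)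
    same : labels M 2 n ≡ word ts
    same = labels-edgesOf 2 (word ts) len
    start : cut M 0 ≡ base
    -- The run through the cuts of `M` and the run through the tiles read the same word, so they end
    -- in the same state.
    start = Run-end (subst (2 ≤_) (sym len) (≤-trans (n≤1+n 2) n≥3))
      (subst (λ w → Run (cut M 0) w (cut M 0)) same (run-around pm 0)) (Run-word ts)
    odd : ∀ i → Odd (cut M i)
    odd zero    = subst Odd (sym start) refl
    odd (suc i) = Odd-next (cut M i) (lab M (2 + i)) (fits-cut pm i) (odd i)
    some : ∃[ i ] spoke i ∈ M
    some = let i , h = spoke-in-word 3∈ in 2 + i , ∈-edgesOf⁺ 2 (word ts) i spokeᴷ h

  continuous : Continuous (Spectrum₂ n n≥3)
  continuous a (suc s) b (M , M∈ , fa) (M′ , M′∈ , fb) (s≤s a≤s) s<b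
    with ℳ₂⇒tiles M∈ | ℳ₂⇒tiles M′∈
  ... | pm , o , ts , eq | pm′ , o′ , ts′ , eq′ = conclude
    (between {ts} {ts′} s (trans span-ts (sym span-ts′))
      (Forceable-mono a≤s (subst (λ w → Forceable w a) eq (proj₁ (forcingNumber⇒masks pm o fa))))
      (λ f → <⇒≱ s<b (proj₂ (forcingNumber⇒masks pm′ o′ fb) (subst (λ w → Forceable w (suc s)) (sym eq′) f))))
    where
    span-ts : span ts ≡ n
    span-ts = trans (cong length (sym eq)) (length-labels M (2 + o) n)
    span-ts′ : span ts′ ≡ n
    span-ts′ = trans (cong length (sym eq′)) (length-labels M′ (2 + o′) n)
    conclude : ∃[ z ] three ∈ z × span z ≡ span ts × ForceableT z (suc s) × ¬ ForceableT z s → Spectrum₂ n n≥3 (suc s)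
    conclude (z , 3∈ , span-z , f , ¬f) =
      let N∈ , same = tiles⇒ℳ₂ 3∈ (trans span-z span-ts) in
      edgesOf 2 (word z) , N∈ , masks⇒forcingNumber (proj₁ N∈) 0
        (subst (λ w → Forceable w (suc s)) (sym same) f)
        (λ g → ≰⇒> λ j≤s → ¬f (Forceable-mono j≤s (subst (λ w → Forceable w _) same g)))

-- The case n = 4 and the conclusion

forcingNumber-≤ : ∀ {G : SimpleGraph} {M M′ k k′} → M ∼[ set ] M′ →
                  ForcingNumber G M k → ForcingNumber G M′ k′ → k′ ≤ k
forcingNumber-≤ M∼M′ f f′ with ForcingNumber.attained f
... | S , fs , eq = subst (_ ≤_) eq (ForcingNumber.minimal f′ S record
  { unique  = unique
  ; subset  = λ e∈ → Equivalence.to M∼M′ (subset e∈)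
  ; forcing = λ N pm sub → let N∼M = forcing N pm sub in
      mk⇔ (Equivalence.to M∼M′ ∘ Equivalence.to N∼M) (Equivalence.from N∼M ∘ Equivalence.from M∼M′)
  })
  where open IsForcingSet fs

theorem4p3 : (n : ℕ) (n≥3 : 3 ≤ n) → Continuous (Spectrum₂ n n≥3)
theorem4p3 n n≥3 with n ≟ 4
... | no n≢4 = Matchings.continuous n n≥3 n≢4
-- For n = 4 all members of ℳ₂ are the same set of edges, so two different values, and hence a < t <
-- b, cannot occur.
... | yes n≡4 = λ a t b (M , (_ , M∈) , fa) (M′ , (_ , M′∈) , fb) a<t t<b →
  contradiction (forcingNumber-≤ {G = P n n≥3} (same M∈ M′∈) fa fb) (<⇒≱ (<-trans a<t t<b))
  where
  same : ∀ {M M′} → (n ≢ 4 × (SpokeCase n n≥3 M ⊎ SpokelessCase n n≥3 M)) ⊎ (n ≡ 4 × FourCase n n≥3 M) →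
         (n ≢ 4 × (SpokeCase n n≥3 M′ ⊎ SpokelessCase n n≥3 M′)) ⊎ (n ≡ 4 × FourCase n n≥3 M′) → M ∼[ set ] M′
  same (inj₁ (n≢4 , _)) _                = contradiction n≡4 n≢4
  same _                (inj₁ (n≢4 , _)) = contradiction n≡4 n≢4
  same (inj₂ (_ , p))   (inj₂ (_ , q))   =
    mk⇔ (Equivalence.from q ∘ Equivalence.to p) (Equivalence.from p ∘ Equivalence.to q)
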